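{- For every integer $n\ge 3$, $$|\mathcal{M}_2(P(n))|=\begin{cases}1 & \text{if } n=4,\\[4pt] \displaystyle\sum_{\substack{0\le l\le \lfloor n/3\rfloor\\ n-3l\equiv 0\ (\mathrm{mod}\ 4)}} \frac{n}{\,l+\frac{n-3l}{4}\,}\binom{l+\frac{n-3l}{4}}{l} & \text{otherwise.}\end{cases}$$
   Context: For $n\ge 3$, $P(n)=P(n,2)$ is the simple graph with vertex set $\{u_i,v_i:0\le i\le n-1\}$ and edge set $\{u_iu_{i+2},\,u_iv_i,\,v_iv_{i+1}:0\le i\le n-1\}$, subscripts modulo $n$. The edges $u_iv_i$ are called spokes. For $n\neq 4$, $\mathcal{M}_2(P(n))$ is the set of perfect matchings $M$ of $P(n)$ such that either (i) $M$ contains at least one spoke, and for any two (cyclically) consecutive spokes $u_iv_i,u_jv_j$ of $M$ the number of spokes $u_kv_k$ of $P(n)$ strictly between them, $j-i-1$ (with $j$ taken as the representative in $(i,i+n]$), is $\equiv 2\pmod 4$ (if $M$ has exactly one spoke $u_iv_i$, it is regarded as two consecutive spokes with $j=i+n$, so the number is $n-1$); or (ii) $M$ contains no spoke, $4\mid n$, and for some $i$, $M=\bigcup_{k=0}^{n/4-1}\{u_{i+4k}u_{i+4k+2},\,u_{i+4k+1}u_{i+4k+3},\,v_{i+4k+1}v_{i+4k+2},\,v_{i+4k+3}v_{i+4k+4}\}$. For $n=4$, $\mathcal{M}_2(P(4))$ consists of the single perfect matching $\{u_0u_2,u_1u_3,v_1v_2,v_3v_0\}$. -}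

module Defs where

open import Data.Fin.Base using (Fin; toℕ)
open import Data.Integer.Base using (+_)
open import Data.List.Base using (map; foldr; upTo)
open import Data.Nat.Base
open import Data.Nat.Combinatorics using (_C_)
open import Data.Nat.Divisibility using (_∣_)
open import Data.Nat.DivMod using (_mod_; m≡m%n+[m/n]*n)
open import Data.Nat.Properties using (_≟_)
open import Data.Product using (Σ; ∃-syntax; ∃!; _×_; _,_; proj₁; swap)
open import Data.Rational.Base as ℚ using (ℚ; 0ℚ)
open import Data.Sum.Base using (_⊎_)
open import Function.Base using (id)
open import Function.Bundles using (Bijection)
open import Level as Level using (0ℓ)
open import Relation.Binary.Bundles using (Setoid)
open import Relation.Binary.Construct.Closure.Symmetric using (SymClosure)
open import Relation.Binary.Core using (Rel; _⇒_; _⇔_)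
open import Relation.Binary.Definitions using (Symmetric)
open import Relation.Binary.PropositionalEquality.Core using (_≡_; _≢_; cong; trans)
open import Relation.Binary.PropositionalEquality.Properties using (setoid)
open import Relation.Nullary.Decidable.Core using (yes; no)
open import Relation.Nullary.Negation.Core using (¬_)

-- A set of (undirected) edges on a vertex set V is encoded as a symmetric
-- relation on V; two edge sets are equal when the relations are equivalent.

record IsPerfectMatching {V : Set} (Adj M : Rel V 0ℓ) : Set where
  field
    M-sym    : Symmetric M
    M⊆Adj    : M ⇒ Adj
    covered! : ∀ x → ∃! _≡_ (M x)

data Vertex (n : ℕ) : Set where
  u v : Fin n → Vertex n

module _ (n : ℕ) .{{_ : NonZero n}} where

  -- Vertices with subscripts read modulo n.
  u⟨_⟩ v⟨_⟩ : ℕ → Vertex n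
  u⟨ k ⟩ = u (k mod n)
  v⟨ k ⟩ = v (k mod n)

  data Edge : Rel (Vertex n) 0ℓ where
    outer : ∀ i → Edge (u i) u⟨ toℕ i + 2 ⟩
    spoke : ∀ i → Edge (u i) (v i)
    inner : ∀ i → Edge (v i) v⟨ toℕ i + 1 ⟩

  -- The graph P(n, 2).  Being a relation it has no multiple edges, and it has
  -- no loops when n ≥ 3.
  P : Rel (Vertex n) 0ℓ
  P = SymClosure Edge

  Spoke : Rel (Vertex n) 0ℓ → ℕ → Set
  Spoke M k = M u⟨ k ⟩ v⟨ k ⟩

  -- The spokes of M at i and j are cyclically consecutive, where j is the
  -- representative in (i, i + n].  The case j = i + n arises exactly when M has
  -- a single spoke.
  record Consecutive (M : Rel (Vertex n) 0ℓ) (i j : ℕ) : Set where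
    field
      i<j          : i < j
      j≤i+n        : j ≤ i + n
      spoke-i      : Spoke M i
      spoke-j      : Spoke M j
      none-between : ∀ k → i < k → k < j → ¬ Spoke M k

  TypeI : Rel (Vertex n) 0ℓ → Set
  TypeI M =
      (∃[ i ] M (u i) (v i))
    × (∀ (i : Fin n) (j : ℕ) → Consecutive M (toℕ i) j → (j ∸ toℕ i ∸ 1) % 4 ≡ 2)

  data SpokelessEdge (i : ℕ) : Rel (Vertex n) 0ℓ where
    u₀u₂ : ∀ k → k < n / 4 → SpokelessEdge i u⟨ i + 4 * k ⟩     u⟨ i + 4 * k + 2 ⟩
    u₁u₃ : ∀ k → k < n / 4 → SpokelessEdge i u⟨ i + 4 * k + 1 ⟩ u⟨ i + 4 * k + 3 ⟩
    v₁v₂ : ∀ k → k < n / 4 → SpokelessEdge i v⟨ i + 4 * k + 1 ⟩ v⟨ i + 4 * k + 2 ⟩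
    v₃v₄ : ∀ k → k < n / 4 → SpokelessEdge i v⟨ i + 4 * k + 3 ⟩ v⟨ i + 4 * k + 4 ⟩

  TypeII : Rel (Vertex n) 0ℓ → Set
  TypeII M =
      (∀ i → ¬ M (u i) (v i))
    × 4 ∣ n
    × (∃[ i ] M ⇔ SymClosure (SpokelessEdge (toℕ {n} i)))

  -- Used only for n = 4.
  data ExceptionalEdge : Rel (Vertex n) 0ℓ where
    u₀u₂ : ExceptionalEdge u⟨ 0 ⟩ u⟨ 2 ⟩
    u₁u₃ : ExceptionalEdge u⟨ 1 ⟩ u⟨ 3 ⟩
    v₁v₂ : ExceptionalEdge v⟨ 1 ⟩ v⟨ 2 ⟩
    v₃v₀ : ExceptionalEdge v⟨ 3 ⟩ v⟨ 0 ⟩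

  record IsM₂ (M : Rel (Vertex n) 0ℓ) : Set where
    field
      isPerfectMatching : IsPerfectMatching P M
      n≢4⇒              : n ≢ 4 → TypeI M ⊎ TypeII M
      n≡4⇒              : n ≡ 4 → M ⇔ SymClosure ExceptionalEdge

  -- Elements are equal when their edge sets are; the proofs of membership play
  -- no role.
  𝓜₂ : Setoid (Level.suc 0ℓ) 0ℓ
  𝓜₂ = record
    { Carrier       = Σ (Rel (Vertex n) 0ℓ) IsM₂
    ; _≈_           = λ M N → proj₁ M ⇔ proj₁ N
    ; isEquivalence = record
      { refl  = id , id
      ; sym   = swap
      ; trans = λ (f , f⁻¹) (g , g⁻¹) → (λ m → g (f m)) , (λ m → f⁻¹ (g⁻¹ m))
      }
    }

  -- The denominator l + (n - 3l) / 4; the truncated subtraction and the floor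
  -- division are exact for the l that occur in the sum.
  den : ℕ → ℕ
  den l = l + (n ∸ 3 * l) / 4

  den-nonZero : ∀ l → (n ∸ 3 * l) % 4 ≡ 0 → NonZero (den l)
  den-nonZero zero    n%4≡0 = ≢-nonZero λ n/4≡0 → ≢-nonZero⁻¹ n
    (trans (m≡m%n+[m/n]*n n 4)
           (trans (cong (_+ n / 4 * 4) n%4≡0) (cong (_* 4) n/4≡0)))
  den-nonZero (suc l) _     = _

  -- Zero unless n - 3l ≡ 0 (mod 4), so that summing over all l ≤ ⌊n/3⌋ yields
  -- the restricted sum.
  term : ℕ → ℚ
  term l with (n ∸ 3 * l) % 4 ≟ 0
  ... | yes p = ((+ n) ℚ./ den l) {{den-nonZero l p}} ℚ.* ((+ (den l C l)) ℚ./ 1)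
  ... | no  _ = 0ℚ

  formula : ℚ
  formula = foldr ℚ._+_ 0ℚ (map term (upTo (suc (n / 3))))

HasCardinality : ∀ {a ℓ} → Setoid a ℓ → ℕ → Set _
HasCardinality S c = Bijection S (setoid (Fin c))

{-# OPTIONS --safe #-}

-- A perfect matching of P(n, 2) records at each index i either the spoke uᵢvᵢ or
-- the directions, forward or back, of the edges at uᵢ and then vᵢ.  The gap
-- condition and the spokeless pattern both amount to the labels tracing out a
-- closed walk in the digraph with cycles sp → bf → fb → sp and
-- ff → bb → bf → fb → ff.  These walks are the tilings of the n-cycle by blocks
-- of lengths 3 and 4.  Cutting at the block containing index 0 leaves a tiling of
-- a segment, so with l blocks of length 3 and q of length 4 there are
--   3 C(l + q - 1, l - 1) + 4 C(l + q - 1, l) = n / (l + q) · C(l + q, l)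
-- of them.

module Submission where

import Algebra.Properties.CommutativeSemigroup as CommutativeSemigroup
open import Axiom.UniquenessOfIdentityProofs using (module Decidable⇒UIP)
open import Data.Bool.Base using (Bool; true; false; if_then_else_)
open import Data.Fin.Base using (Fin; zero; suc; toℕ)
open import Data.Fin.Properties as Fin
  using (toℕ-injective; toℕ-fromℕ<; toℕ<n; any?; +↔⊎; 0↔⊥; 1↔⊤)
open import Data.Integer.Base as ℤ using (+_)
import Data.Integer.Properties as ℤ
open import Data.List.Base using (foldr; applyUpTo; upTo; map)
open import Data.List.Properties using (map-upTo)
open import Data.Nat.Base as ℕ hiding (_/_)
open import Data.Nat.Combinatorics
  using (_C_; nCn≡1; nC1≡n; k>n⇒nCk≡0; nCk+nC[k+1]≡[n+1]C[k+1])
open import Data.Nat.Divisibility using (_∣_; divides; ∣⇒≤; m%n≡0⇒n∣m)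
open import Data.Nat.DivMod hiding (_/_)
open import Data.Nat.ListAction using (sum)
open import Data.Nat.Properties
open import Data.Nat.Tactic.RingSolver using (solve-∀)
open import Data.Product.Base using (Σ; ∃; ∃-syntax; _×_; _,_; proj₁; proj₂)
open import Data.Rational.Base as ℚ using (ℚ; 0ℚ; toℚᵘ; _/_)
import Data.Rational.Properties as ℚ
open import Data.Rational.Unnormalised.Base as ℚᵘ using (mkℚᵘ; *≡*)
import Data.Rational.Unnormalised.Properties as ℚᵘ
open import Data.Sum.Base using (_⊎_; inj₁; inj₂)
open import Data.Sum.Function.Propositional using (_⊎-↔_)
open import Defs
open import Function.Bundles using (_↔_; mk↔ₛ′; mk↣; Inverse; Injection)
open import Function.Properties.Inverse using (↔-sym; ↔-trans; Inverse⇒Injection)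
open import Level using (0ℓ)
open import Relation.Binary.Bundles using (Setoid)
open import Relation.Binary.Construct.Closure.Symmetric using (SymClosure; fwd; bwd; symmetric)
open import Relation.Binary.Core using (Rel; _⇒_)
open import Relation.Binary.Definitions using (DecidableEquality)
open import Relation.Binary.PropositionalEquality
import Relation.Binary.Reasoning.Setoid as SetoidReasoning
open import Relation.Nullary.Decidable using (Dec; yes; no; does; map′; via-injection)
open import Relation.Nullary.Negation using (¬_; contradiction)

open CommutativeSemigroup +-commutativeSemigroup using (interchange; x∙yz≈y∙xz)

-- Two obstacles shape the proof. First, agreement of the two ends of every edge admits more
-- labellings than the digraph does: a spoke may be followed at once by another one, or by
-- `ff fb bf bb` repeated, with a multiple of 4 indices before the next spoke. The gap condition
-- asks for residue 2 and so excludes both, which makes every spoke be followed by `bf`; in the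
-- spokeless case the pattern itself exhibits a step `fb→ff`. From one such step, agreement of the
-- ends carries the walk around the whole cycle. Second, labels can be read off a matching only if
-- the forward and the back neighbour differ. At `n = 4` the vertices uᵢ₊₂ and uᵢ₋₂ coincide, so
-- that length is handled apart. In the count, n / (l + q) need not be an integer, so each summand
-- is compared after multiplication by l + q; the two parts of the count then become 3 l and 4 q
-- times the binomial coefficient.

-- The first letter tells whether the edge at uᵢ leads forward (to uᵢ₊₂) or back,
-- the second whether the edge at vᵢ does; sp stands for the spoke.
data Label : Set where
  sp bf fb ff bb : Label

data Step : Label → Label → Set where
  sp→bf : Step sp bf
  bf→fb : Step bf fb
  fb→sp : Step fb sp
  fb→ff : Step fb ff
  ff→bb : Step ff bb
  bb→bf : Step bb bf

_≟ˡ_ : DecidableEquality Label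
_≟ˡ_ = via-injection (mk↣ {to = code} (λ {x} {y} → code-injective x y)) _≟_
  where
  code : Label → ℕ
  code sp = 0
  code bf = 1
  code fb = 2
  code ff = 3
  code bb = 4
  decode : ℕ → Label
  decode 0 = sp
  decode 1 = bf
  decode 2 = fb
  decode 3 = ff
  decode _ = bb
  decode-code : ∀ x → decode (code x) ≡ x
  decode-code sp = refl
  decode-code bf = refl
  decode-code fb = refl
  decode-code ff = refl
  decode-code bb = refl
  code-injective : ∀ x y → code x ≡ code y → x ≡ y
  code-injective x y eq = trans (sym (decode-code x)) (trans (cong decode eq) (decode-code y))

open Decidable⇒UIP _≟ˡ_ using () renaming (≡-irrelevant to ≡ˡ-irrelevant)

infixr 5 _∷_

-- The equation in `[]` lets a walk end at a label only provably equal to its last one, which is how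
-- a walk around the cycle closes up in `toWalk`.
data Walk : ℕ → Label → Label → Set where
  []  : ∀ {x y} → x ≡ y → Walk 0 x y
  _∷_ : ∀ {k x y z} → Step x y → Walk k y z → Walk (suc k) x z

walks : ℕ → Label → Label → ℕ
walks zero    x  z = if does (x ≟ˡ z) then 1 else 0
walks (suc k) sp z = walks k bf z
walks (suc k) bf z = walks k fb z
walks (suc k) fb z = walks k sp z + walks k ff z
walks (suc k) ff z = walks k bb z
walks (suc k) bb z = walks k bf z

Walk↔Fin : ∀ k x z → Walk k x z ↔ Fin (walks k x z)
Walk↔Fin zero x z = finite (x ≟ˡ z)
  where
  finite : (d : Dec (x ≡ z)) → Walk 0 x z ↔ Fin (if does d then 1 else 0)
  finite (yes p) = ↔-trans
    (mk↔ₛ′ _ (λ _ → [] p) (λ _ → refl) λ { ([] q) → cong [] (≡ˡ-irrelevant p q) })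
    (↔-sym 1↔⊤)
  finite (no ¬p) = ↔-trans
    (mk↔ₛ′ (λ { ([] p) → ¬p p }) (λ ()) (λ ()) λ { ([] p) → contradiction p ¬p })
    (↔-sym 0↔⊥)
Walk↔Fin (suc k) sp z = ↔-trans
  (mk↔ₛ′ (λ { (sp→bf ∷ p) → p }) (sp→bf ∷_) (λ _ → refl) λ { (sp→bf ∷ _) → refl })
  (Walk↔Fin k bf z)
Walk↔Fin (suc k) bf z = ↔-trans
  (mk↔ₛ′ (λ { (bf→fb ∷ p) → p }) (bf→fb ∷_) (λ _ → refl) λ { (bf→fb ∷ _) → refl })
  (Walk↔Fin k fb z)
Walk↔Fin (suc k) fb z = ↔-trans
  (mk↔ₛ′ (λ { (fb→sp ∷ p) → inj₁ p ; (fb→ff ∷ p) → inj₂ p })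
         (λ { (inj₁ p) → fb→sp ∷ p ; (inj₂ p) → fb→ff ∷ p })
         (λ { (inj₁ _) → refl ; (inj₂ _) → refl })
         (λ { (fb→sp ∷ _) → refl ; (fb→ff ∷ _) → refl }))
  (↔-trans (Walk↔Fin k sp z ⊎-↔ Walk↔Fin k ff z) (↔-sym +↔⊎))
Walk↔Fin (suc k) ff z = ↔-trans
  (mk↔ₛ′ (λ { (ff→bb ∷ p) → p }) (ff→bb ∷_) (λ _ → refl) λ { (ff→bb ∷ _) → refl })
  (Walk↔Fin k bb z)
Walk↔Fin (suc k) bb z = ↔-trans
  (mk↔ₛ′ (λ { (bb→bf ∷ p) → p }) (bb→bf ∷_) (λ _ → refl) λ { (bb→bf ∷ _) → refl })
  (Walk↔Fin k bf z)

ClosedWalk : ℕ → Set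
ClosedWalk k = Σ Label λ x → Walk k x x

closedWalks : ℕ → ℕ
closedWalks k =
  walks k sp sp + (walks k bf bf + (walks k fb fb + (walks k ff ff + walks k bb bb)))

ClosedWalk↔Fin : ∀ k → ClosedWalk k ↔ Fin (closedWalks k)
ClosedWalk↔Fin k = ↔-trans
  (mk↔ₛ′ (λ { (sp , p) → inj₁ p
            ; (bf , p) → inj₂ (inj₁ p)
            ; (fb , p) → inj₂ (inj₂ (inj₁ p))
            ; (ff , p) → inj₂ (inj₂ (inj₂ (inj₁ p)))
            ; (bb , p) → inj₂ (inj₂ (inj₂ (inj₂ p))) })
         (λ { (inj₁ p) → sp , p
            ; (inj₂ (inj₁ p)) → bf , p
            ; (inj₂ (inj₂ (inj₁ p))) → fb , p
            ; (inj₂ (inj₂ (inj₂ (inj₁ p)))) → ff , p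
            ; (inj₂ (inj₂ (inj₂ (inj₂ p)))) → bb , p })
         (λ { (inj₁ _) → refl
            ; (inj₂ (inj₁ _)) → refl
            ; (inj₂ (inj₂ (inj₁ _))) → refl
            ; (inj₂ (inj₂ (inj₂ (inj₁ _)))) → refl
            ; (inj₂ (inj₂ (inj₂ (inj₂ _)))) → refl })
         (λ { (sp , _) → refl ; (bf , _) → refl ; (fb , _) → refl
            ; (ff , _) → refl ; (bb , _) → refl }))
  (count sp ⊎+ (count bf ⊎+ (count fb ⊎+ (count ff ⊎+ count bb))))
  where
  count : ∀ x → Walk k x x ↔ Fin (walks k x x)
  count x = Walk↔Fin k x x
  infixr 4 _⊎+_
  _⊎+_ : ∀ {P Q : Set} {m n} → P ↔ Fin m → Q ↔ Fin n → (P ⊎ Q) ↔ Fin (m + n)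
  f ⊎+ g = ↔-trans (f ⊎-↔ g) (↔-sym +↔⊎)

-- Walks as functions on indices

label : ∀ {k x z} → Walk k x z → ℕ → Label
label {x = x} ([] _)  _       = x
label {x = x} (_ ∷ _) zero    = x
label         (_ ∷ p) (suc i) = label p i

label-start : ∀ {k x z} (p : Walk k x z) → label p 0 ≡ x
label-start ([] _)  = refl
label-start (_ ∷ _) = refl

label-end : ∀ {k x z} (p : Walk k x z) → label p k ≡ z
label-end ([] eq) = eq
label-end (_ ∷ p) = label-end p

label-step : ∀ {k x z} (p : Walk k x z) {i} → i < k → Step (label p i) (label p (suc i))
label-step (s ∷ p) {zero}  _         = subst (Step _) (sym (label-start p)) s
label-step (s ∷ p) {suc i} (s≤s i<k) = label-step p i<k

walk : (f : ℕ → Label) → (∀ i → Step (f i) (f (suc i))) →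
       ∀ k {z} → f k ≡ z → Walk k (f 0) z
walk f step zero    eq = [] eq
walk f step (suc k) eq = step 0 ∷ walk (λ i → f (suc i)) (λ i → step (suc i)) k eq

label-walk : ∀ f step k {z} (eq : f k ≡ z) {i} → i ≤ k → label (walk f step k eq) i ≡ f i
label-walk f step zero    eq {zero}  _         = refl
label-walk f step (suc k) eq {zero}  _         = refl
label-walk f step (suc k) eq {suc i} (s≤s i≤k) =
  label-walk (λ i → f (suc i)) (λ i → step (suc i)) k eq i≤k

Step-irrelevant : ∀ {x y} (s t : Step x y) → s ≡ t
Step-irrelevant sp→bf sp→bf = refl
Step-irrelevant bf→fb bf→fb = refl
Step-irrelevant fb→sp fb→sp = refl
Step-irrelevant fb→ff fb→ff = refl
Step-irrelevant ff→bb ff→bb = refl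
Step-irrelevant bb→bf bb→bf = refl

label-injective : ∀ {k x z} (p q : Walk k x z) → (∀ i → i ≤ k → label p i ≡ label q i) → p ≡ q
label-injective ([] eq) ([] eq′) _ = cong [] (≡ˡ-irrelevant eq eq′)
label-injective (s ∷ p) (t ∷ q) p≗q
  with refl ← trans (sym (label-start p)) (trans (p≗q 1 (s≤s z≤n)) (label-start q)) =
  cong₂ _∷_ (Step-irrelevant s t) (label-injective p q λ i i≤k → p≗q (suc i) (s≤s i≤k))

-- The number of closed walks

-- The recursion of `walks` strips first steps; reducing the closed walks at all five labels to
-- those at `fb` requires stripping last steps too. `base` expresses that `y` is the only
-- predecessor of `z`, and both sides unfold along the same first steps.
walks-into : ∀ y z → (∀ x → walks 1 x z ≡ walks 0 x y) → ∀ k x → walks (suc k) x z ≡ walks k x y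
walks-into y z base zero    x  = base x
walks-into y z base (suc k) sp = walks-into y z base k bf
walks-into y z base (suc k) bf = walks-into y z base k fb
walks-into y z base (suc k) fb = cong₂ _+_ (walks-into y z base k sp) (walks-into y z base k ff)
walks-into y z base (suc k) ff = walks-into y z base k bb
walks-into y z base (suc k) bb = walks-into y z base k bf

walks-into-sp : ∀ k x → walks (suc k) x sp ≡ walks k x fb
walks-into-sp = walks-into fb sp λ { sp → refl ; bf → refl ; fb → refl ; ff → refl ; bb → refl }

walks-into-ff : ∀ k x → walks (suc k) x ff ≡ walks k x fb
walks-into-ff = walks-into fb ff λ { sp → refl ; bf → refl ; fb → refl ; ff → refl ; bb → refl }

walks-into-bb : ∀ k x → walks (suc k) x bb ≡ walks k x ff
walks-into-bb = walks-into ff bb λ { sp → refl ; bf → refl ; fb → refl ; ff → refl ; bb → refl }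

walks-into-bf : ∀ k x → walks (suc k) x bf ≡ walks k x sp + walks k x bb
walks-into-bf zero    sp = refl
walks-into-bf zero    bf = refl
walks-into-bf zero    fb = refl
walks-into-bf zero    ff = refl
walks-into-bf zero    bb = refl
walks-into-bf (suc k) sp = walks-into-bf k bf
walks-into-bf (suc k) bf = walks-into-bf k fb
walks-into-bf (suc k) fb =
  trans (cong₂ _+_ (walks-into-bf k sp) (walks-into-bf k ff))
        (interchange (walks k sp sp) (walks k sp bb) (walks k ff sp) (walks k ff bb))
walks-into-bf (suc k) ff = walks-into-bf k bb
walks-into-bf (suc k) bb = walks-into-bf k bf

-- A closed walk at fb is a tiling of a segment by the blocks sp bf fb and
-- ff bb bf fb; a closed walk elsewhere starts inside one of the blocks.
closedWalks-fb : ∀ m → closedWalks (4 + m) ≡ 3 * walks (1 + m) fb fb + 4 * walks m fb fb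
closedWalks-fb m
  rewrite walks-into-sp (1 + m) fb
        | walks-into-bf (2 + m) fb | walks-into-sp (1 + m) fb
        | walks-into-bb (1 + m) fb | walks-into-ff m fb =
  total (walks m sp fb + walks m ff fb) (walks m fb fb)
  where
  total : ∀ a t → a + (a + t + (a + t + (t + t))) ≡ 3 * a + 4 * t
  total = solve-∀

-- Tilings by a given number of blocks

-- Here `m` is the length of the segment and `l` the number of blocks of length 3; the remaining
-- blocks have length 4. The recursion removes an end block.
tilings : (m l : ℕ) → ℕ
tilings 0 0       = 1
tilings 0 (suc l) = 0
tilings 1 l       = 0
tilings 2 l       = 0
tilings 3 0       = 0
tilings 3 (suc l) = tilings 0 l
tilings (suc (suc (suc (suc m)))) 0       = tilings m 0
tilings (suc (suc (suc (suc m)))) (suc l) = tilings (suc m) l + tilings m (suc l)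

∑ : ℕ → (ℕ → ℕ) → ℕ
∑ L f = sum (applyUpTo f L)

∑-+ : ∀ L f g → ∑ L (λ l → f l + g l) ≡ ∑ L f + ∑ L g
∑-+ zero    f g = refl
∑-+ (suc L) f g =
  trans (cong (λ s → f 0 + g 0 + s) (∑-+ L (λ l → f (suc l)) (λ l → g (suc l))))
        (interchange (f 0) (g 0) _ _)

∑-* : ∀ L a f → ∑ L (λ l → a * f l) ≡ a * ∑ L f
∑-* zero    a f = sym (*-zeroʳ a)
∑-* (suc L) a f =
  trans (cong (λ s → a * f 0 + s) (∑-* L a (λ l → f (suc l))))
        (sym (*-distribˡ-+ a (f 0) _))

∑-zero : ∀ L → ∑ L (λ _ → 0) ≡ 0
∑-zero zero    = refl
∑-zero (suc L) = ∑-zero L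

3+m<3*[1+n]⇒m<3*n : ∀ m n → 3 + m < 3 * suc n → m < 3 * n
3+m<3*[1+n]⇒m<3*n m n lt = +-cancelˡ-< 3 m (3 * n) (subst (3 + m <_) (*-suc 3 n) lt)

-- Both sides satisfy T(m + 4) = T(m + 1) + T(m): a walk leaving `fb` runs through one whole block
-- before it is at `fb` again. The bound on `L` makes the sum reach every `l` with `3 * l ≤ m`.
∑-tilings : ∀ m L → m < 3 * L → ∑ L (tilings m) ≡ walks m fb fb
∑-tilings m zero ()
∑-tilings 0 (suc L) _  = cong suc (∑-zero L)
∑-tilings 1 (suc L) _  = ∑-zero L
∑-tilings 2 (suc L) _  = ∑-zero L
∑-tilings 3 (suc L) lt = ∑-tilings 0 L (3+m<3*[1+n]⇒m<3*n 0 L lt)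
∑-tilings (suc (suc (suc (suc m)))) (suc L) lt = begin
  tilings m 0 + ∑ L (λ l → tilings (suc m) l + tilings m (suc l))
    ≡⟨ cong (λ s → tilings m 0 + s) (∑-+ L (tilings (suc m)) (λ l → tilings m (suc l))) ⟩
  tilings m 0 + (∑ L (tilings (suc m)) + ∑ L (λ l → tilings m (suc l)))
    ≡⟨ x∙yz≈y∙xz (tilings m 0) (∑ L (tilings (suc m))) _ ⟩
  ∑ L (tilings (suc m)) + ∑ (suc L) (tilings m)
    ≡⟨ cong₂ _+_ (∑-tilings (suc m) L (3+m<3*[1+n]⇒m<3*n (suc m) L lt))
                 (∑-tilings m (suc L) (≤-trans (m≤n+m (suc m) 4) lt)) ⟩
  walks (suc m) fb fb + walks m fb fb ∎
  where open ≡-Reasoning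

-- 3 l + 4 q, unfolding in l before q.
size : (l q : ℕ) → ℕ
size zero    zero    = 0
size zero    (suc q) = 4 + size zero q
size (suc l) q       = 3 + size l q

size≡ : ∀ l q → size l q ≡ 3 * l + 4 * q
size≡ zero    zero    = refl
size≡ zero    (suc q) = trans (cong (λ s → 4 + s) (size≡ zero q)) (sym (*-suc 4 q))
size≡ (suc l) q       = trans (cong (λ s → 3 + s) (size≡ l q)) (cong (_+ 4 * q) (sym (*-suc 3 l)))

size-suc : ∀ l q → size l (suc q) ≡ 4 + size l q
size-suc zero    q = refl
size-suc (suc l) q = cong (λ s → 3 + s) (size-suc l q)

-- This accounts for the values of `l` that the restricted sum omits.
tilings-support : ∀ m l → tilings m l ≡ 0 ⊎ ∃[ q ] m ≡ size l q
tilings-support 0 0       = inj₂ (0 , refl)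
tilings-support 0 (suc l) = inj₁ refl
tilings-support 1 l       = inj₁ refl
tilings-support 2 l       = inj₁ refl
tilings-support 3 0       = inj₁ refl
tilings-support 3 (suc l) with tilings-support 0 l
... | inj₁ ≡0       = inj₁ ≡0
... | inj₂ (q , eq) = inj₂ (q , cong (λ s → 3 + s) eq)
tilings-support (suc (suc (suc (suc m)))) 0 with tilings-support m 0
... | inj₁ ≡0       = inj₁ ≡0
... | inj₂ (q , eq) = inj₂ (suc q , cong (λ s → 4 + s) eq)
tilings-support (suc (suc (suc (suc m)))) (suc l)
  with tilings-support (suc m) l | tilings-support m (suc l)
... | inj₂ (q , eq) | _             = inj₂ (q , cong (λ s → 3 + s) eq)
... | _             | inj₂ (q , eq) =
  inj₂ (suc q , trans (cong (λ s → 4 + s) eq) (sym (size-suc (suc l) q)))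
... | inj₁ ≡0       | inj₁ ≡0′      = inj₁ (cong₂ _+_ ≡0 ≡0′)

tilings-few : ∀ m l → m < 3 * l → tilings m l ≡ 0
tilings-few m l m<3l with tilings-support m l
... | inj₁ ≡0       = ≡0
... | inj₂ (q , eq) = contradiction m<3l (≤⇒≯ (begin
  3 * l         ≤⟨ m≤m+n (3 * l) (4 * q) ⟩
  3 * l + 4 * q ≡⟨ size≡ l q ⟨
  size l q      ≡⟨ eq ⟨
  m             ∎))
  where open ≤-Reasoning

size-0 : ∀ l → size l 0 ≡ 3 * l
size-0 l = trans (size≡ l 0) (+-identityʳ (3 * l))

-- A tiling is fixed by which `l` of its `l + q` blocks are short, and removing the end block is
-- Pascal's rule.
tilings-size : ∀ l q → tilings (size l q) l ≡ (l + q) C l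
tilings-size zero          zero    = refl
tilings-size zero          (suc q) = tilings-size zero q
tilings-size (suc zero)    zero    = refl
tilings-size (suc (suc l)) zero    = begin
  tilings (3 + size l 0) (suc l) + tilings (2 + size l 0) (2 + l)
    ≡⟨ cong₂ _+_ (tilings-size (suc l) zero) (tilings-few (2 + size l 0) (2 + l) few) ⟩
  (suc l + 0) C suc l + 0                    ≡⟨ +-identityʳ _ ⟩
  (suc l + 0) C suc l                        ≡⟨ cong (_C suc l) (+-identityʳ (suc l)) ⟩
  suc l C suc l                              ≡⟨ nCn≡1 (suc l) ⟩
  1                                          ≡⟨ nCn≡1 (suc (suc l)) ⟨
  suc (suc l) C suc (suc l)                  ≡⟨ cong (_C suc (suc l)) (+-identityʳ (suc (suc l))) ⟨
  (suc (suc l) + 0) C suc (suc l)            ∎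
  where
  open ≡-Reasoning
  -- Without long blocks the second branch vanishes: after removing 4, the remaining length
  -- `3 * l + 2` is too short for `2 + l` short blocks.
  few : 2 + size l 0 < 3 * (2 + l)
  few = <-≤-trans (s≤s (s≤s (s≤s (≤-reflexive (size-0 l)))))
                  (≤-trans (≤-reflexive (sym (*-suc 3 l))) (*-monoʳ-≤ 3 (n≤1+n (suc l))))
tilings-size (suc l) (suc q) = begin
  tilings (3 + size l (suc q)) (suc l)
    ≡⟨ cong (λ m → tilings (3 + m) (suc l)) (size-suc l q) ⟩
  tilings (4 + size l q) l + tilings (size (suc l) q) (suc l)
    ≡⟨ cong₂ _+_ (trans (cong (λ m → tilings m l) (sym (size-suc l q))) (tilings-size l (suc q)))
                 (tilings-size (suc l) q) ⟩
  (l + suc q) C l + (suc l + q) C suc l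
    ≡⟨ cong (λ N → (l + suc q) C l + N C suc l) (sym (+-suc l q)) ⟩
  (l + suc q) C l + (l + suc q) C suc l
    ≡⟨ nCk+nC[k+1]≡[n+1]C[k+1] (l + suc q) l ⟩
  (suc l + suc q) C suc l ∎
  where open ≡-Reasoning

-- The absorption identity, by induction through Pascal's rule.
[1+k]*[1+n]C[1+k]≡[1+n]*nCk : ∀ n k → suc k * (suc n C suc k) ≡ suc n * (n C k)
[1+k]*[1+n]C[1+k]≡[1+n]*nCk zero zero = refl
[1+k]*[1+n]C[1+k]≡[1+n]*nCk zero (suc k) =
  trans (cong (suc (suc k) *_) (k>n⇒nCk≡0 {1} {suc (suc k)} (s≤s (s≤s z≤n)))) (*-zeroʳ (suc (suc k)))
[1+k]*[1+n]C[1+k]≡[1+n]*nCk (suc n) zero =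
  trans (*-identityˡ _) (trans (nC1≡n (suc (suc n))) (sym (*-identityʳ (suc (suc n)))))
[1+k]*[1+n]C[1+k]≡[1+n]*nCk (suc n) (suc k) = begin
  suc (suc k) * (suc (suc n) C suc (suc k))
    ≡⟨ cong (suc (suc k) *_) (nCk+nC[k+1]≡[n+1]C[k+1] (suc n) (suc k)) ⟨
  suc (suc k) * (X + suc n C suc (suc k))
    ≡⟨ split k X (suc n C suc (suc k)) ⟩
  X + (suc k * X + suc (suc k) * (suc n C suc (suc k)))
    ≡⟨ cong (λ s → X + s) (cong₂ _+_ ([1+k]*[1+n]C[1+k]≡[1+n]*nCk n k)
                              ([1+k]*[1+n]C[1+k]≡[1+n]*nCk n (suc k))) ⟩
  X + (suc n * (n C k) + suc n * (n C suc k))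
    ≡⟨ cong (λ s → X + s) (*-distribˡ-+ (suc n) (n C k) (n C suc k)) ⟨
  X + suc n * (n C k + n C suc k)
    ≡⟨ cong (λ c → X + suc n * c) (nCk+nC[k+1]≡[n+1]C[k+1] n k) ⟩
  suc (suc n) * X ∎
  where
  open ≡-Reasoning
  X = suc n C suc k
  split : ∀ k x y → suc (suc k) * (x + y) ≡ x + (suc k * x + suc (suc k) * y)
  split = solve-∀

-- The number of closed walks of length 4 + m through l blocks sp bf fb: index 0
-- lies in one of them at one of 3 offsets, or in a longer block at one of 4.
closedTilings : (m l : ℕ) → ℕ
closedTilings m zero    = 4 * tilings m zero
closedTilings m (suc l) = 3 * tilings (suc m) l + 4 * tilings m (suc l)

∑-closedTilings : ∀ m L → m < 3 * suc L → suc m < 3 * L →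
                  ∑ (suc L) (closedTilings m) ≡ closedWalks (4 + m)
∑-closedTilings m L m< 1+m< = begin
  4 * tilings m 0 + ∑ L (λ l → 3 * tilings (suc m) l + 4 * tilings m (suc l))
    ≡⟨ cong (λ s → 4 * tilings m 0 + s) (∑-+ L (λ l → 3 * tilings (suc m) l) (λ l → 4 * tilings m (suc l))) ⟩
  4 * tilings m 0 + (∑ L (λ l → 3 * tilings (suc m) l) + ∑ L (λ l → 4 * tilings m (suc l)))
    ≡⟨ x∙yz≈y∙xz (4 * tilings m 0) (∑ L (λ l → 3 * tilings (suc m) l)) _ ⟩
  ∑ L (λ l → 3 * tilings (suc m) l) + ∑ (suc L) (λ l → 4 * tilings m l)
    ≡⟨ cong₂ _+_ (∑-* L 3 (tilings (suc m))) (∑-* (suc L) 4 (tilings m)) ⟩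
  3 * ∑ L (tilings (suc m)) + 4 * ∑ (suc L) (tilings m)
    ≡⟨ cong₂ (λ x y → 3 * x + 4 * y) (∑-tilings (suc m) L 1+m<) (∑-tilings m (suc L) m<) ⟩
  3 * walks (suc m) fb fb + 4 * walks m fb fb
    ≡⟨ closedWalks-fb m ⟨
  closedWalks (4 + m) ∎
  where open ≡-Reasoning

-- `closedTilings m l` has the summands of `tilings (4 + m) l`, weighted by 3 and 4, so it vanishes
-- together with it.
closedTilings-support : ∀ m l → closedTilings m l ≡ 0 ⊎ ∃[ q ] 4 + m ≡ size l q
closedTilings-support m l with tilings-support (4 + m) l
... | inj₂ found = inj₂ found
closedTilings-support m zero    | inj₁ ≡0 = inj₁ (cong (4 *_) ≡0)
closedTilings-support m (suc l) | inj₁ ≡0 =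
  inj₁ (cong₂ (λ x y → 3 * x + 4 * y) (m+n≡0⇒m≡0 (tilings (suc m) l) ≡0) (m+n≡0⇒n≡0 (tilings (suc m) l) ≡0))

-- Multiplied by the number of blocks, the 3-part becomes `3 * l` and the 4-part `4 * q` times the
-- same binomial coefficient, and `3 * l + 4 * q` is the length of the cycle.
closedTilings-size : ∀ m l q → 4 + m ≡ size l q →
                     closedTilings m l * (l + q) ≡ (4 + m) * ((l + q) C l)
closedTilings-size m zero (suc q) eq with refl ← +-cancelˡ-≡ 4 m (size 0 q) eq = begin
  4 * tilings (size 0 q) 0 * suc q  ≡⟨ cong (λ c → 4 * c * suc q) (tilings-size 0 q) ⟩
  4 * suc q                         ≡⟨ size≡ 0 (suc q) ⟨
  4 + size 0 q                      ≡⟨ *-identityʳ _ ⟨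
  (4 + size 0 q) * 1                ∎
  where open ≡-Reasoning
closedTilings-size m (suc l) q eq = begin-equality
  (3 * tilings (suc m) l + 4 * tilings m (suc l)) * suc N
    ≡⟨ cong₂ (λ x y → (3 * x + 4 * y) * suc N)
             (trans (cong (λ k → tilings k l) eq′) (tilings-size l q)) (rest q eq) ⟩
  (3 * X + 4 * Y) * suc N
    ≡⟨ expand X Y (suc N) ⟩
  3 * (suc N * X) + 4 * (suc N * Y)
    ≡⟨ cong₂ (λ x y → 3 * x + 4 * y) ([1+k]*[1+n]C[1+k]≡[1+n]*nCk N l) (sym Y-share) ⟨
  3 * (suc l * K) + 4 * (q * K)
    ≡⟨ collect (suc l) q K ⟩
  (3 * suc l + 4 * q) * K
    ≡⟨ cong (_* K) (trans eq (size≡ (suc l) q)) ⟨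
  (4 + m) * K ∎
  where
  open ≤-Reasoning
  N = l + q
  X = N C l
  Y = N C suc l
  K = suc N C suc l
  eq′ : suc m ≡ size l q
  eq′ = +-cancelˡ-≡ 3 (suc m) (size l q) eq
  -- Removing one of the `q` long blocks leaves `l + q` blocks, `suc l` of them short. For `q = 0`
  -- there is none to remove and both sides are 0.
  rest : ∀ q → 4 + m ≡ size (suc l) q → tilings m (suc l) ≡ (l + q) C suc l
  rest zero    eq = trans (tilings-few m (suc l) (begin-strict
      m           <⟨ n<1+n m ⟩
      suc m       ≡⟨ +-cancelˡ-≡ 3 (suc m) (size l 0) eq ⟩
      size l 0    ≡⟨ size-0 l ⟩
      3 * l       ≤⟨ *-monoʳ-≤ 3 (n≤1+n l) ⟩
      3 * suc l   ∎))
    (sym (k>n⇒nCk≡0 {l + 0} (s≤s (≤-reflexive (+-identityʳ l)))))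
  rest (suc q) eq = trans
    (cong (λ k → tilings k (suc l)) (+-cancelˡ-≡ 4 m _ (trans eq (size-suc (suc l) q))))
    (trans (tilings-size (suc l) q) (cong (_C suc l) (sym (+-suc l q))))
  -- The companion of absorption: cancel the absorbed part from Pascal's rule multiplied by `suc N`.
  Y-share : suc N * Y ≡ q * K
  Y-share = +-cancelˡ-≡ (suc N * X) _ _ (begin-equality
    suc N * X + suc N * Y  ≡⟨ *-distribˡ-+ (suc N) X Y ⟨
    suc N * (X + Y)        ≡⟨ cong (suc N *_) (nCk+nC[k+1]≡[n+1]C[k+1] N l) ⟩
    (suc l + q) * K        ≡⟨ *-distribʳ-+ K (suc l) q ⟩
    suc l * K + q * K      ≡⟨ cong (_+ q * K) ([1+k]*[1+n]C[1+k]≡[1+n]*nCk N l) ⟩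
    suc N * X + q * K      ∎)
  expand : ∀ x y n → (3 * x + 4 * y) * n ≡ 3 * (n * x) + 4 * (n * y)
  expand = solve-∀
  collect : ∀ a q k → 3 * (a * k) + 4 * (q * k) ≡ (3 * a + 4 * q) * k
  collect = solve-∀

-- Rational sums of natural numbers

fraction-product : ∀ a c s d .{{_ : NonZero d}} → s * d ≡ a * c →
                   (+ a ℚ./ d) ℚ.* (+ c ℚ./ 1) ≡ + s ℚ./ 1
fraction-product a c s (suc d) eq = ℚ.toℚᵘ-injective (begin
  toℚᵘ ((+ a ℚ./ suc d) ℚ.* (+ c ℚ./ 1))
    ≈⟨ ℚ.toℚᵘ-homo-* (+ a ℚ./ suc d) (+ c ℚ./ 1) ⟩
  toℚᵘ (+ a ℚ./ suc d) ℚᵘ.* toℚᵘ (+ c ℚ./ 1)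
    ≈⟨ ℚᵘ.*-cong (ℚ.toℚᵘ-fromℚᵘ (mkℚᵘ (+ a) d)) (ℚ.toℚᵘ-fromℚᵘ (mkℚᵘ (+ c) 0)) ⟩
  mkℚᵘ (+ a) d ℚᵘ.* mkℚᵘ (+ c) 0
    ≈⟨ *≡* cross ⟩
  mkℚᵘ (+ s) 0
    ≈⟨ ℚ.toℚᵘ-fromℚᵘ (mkℚᵘ (+ s) 0) ⟨
  toℚᵘ (+ s ℚ./ 1) ∎)
  where
  open SetoidReasoning ℚᵘ.≃-setoid
  cross : (+ a ℤ.* + c) ℤ.* + 1 ≡ + s ℤ.* + (suc d * 1)
  cross = trans (ℤ.*-identityʳ _) (trans (sym (ℤ.pos-* a c)) (trans (cong +_ (sym eq))
    (trans (cong (λ k → + (s * k)) (sym (*-identityʳ (suc d)))) (ℤ.pos-* s (suc d * 1)))))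

/1-homo-+ : ∀ a b → (+ a ℚ./ 1) ℚ.+ (+ b ℚ./ 1) ≡ + (a + b) ℚ./ 1
/1-homo-+ a b = ℚ.toℚᵘ-injective (begin
  toℚᵘ ((+ a ℚ./ 1) ℚ.+ (+ b ℚ./ 1))
    ≈⟨ ℚ.toℚᵘ-homo-+ (+ a ℚ./ 1) (+ b ℚ./ 1) ⟩
  toℚᵘ (+ a ℚ./ 1) ℚᵘ.+ toℚᵘ (+ b ℚ./ 1)
    ≈⟨ ℚᵘ.+-cong (ℚ.toℚᵘ-fromℚᵘ (mkℚᵘ (+ a) 0)) (ℚ.toℚᵘ-fromℚᵘ (mkℚᵘ (+ b) 0)) ⟩
  mkℚᵘ (+ a) 0 ℚᵘ.+ mkℚᵘ (+ b) 0
    ≈⟨ *≡* (cong (ℤ._* + 1) (cong₂ ℤ._+_ (ℤ.*-identityʳ (+ a)) (ℤ.*-identityʳ (+ b)))) ⟩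
  mkℚᵘ (+ (a + b)) 0
    ≈⟨ ℚ.toℚᵘ-fromℚᵘ (mkℚᵘ (+ (a + b)) 0) ⟨
  toℚᵘ (+ (a + b) ℚ./ 1) ∎)
  where open SetoidReasoning ℚᵘ.≃-setoid

foldr-/1 : ∀ L (g : ℕ → ℚ) (f : ℕ → ℕ) → (∀ l → l < L → g l ≡ + f l ℚ./ 1) →
           foldr ℚ._+_ 0ℚ (applyUpTo g L) ≡ + ∑ L f ℚ./ 1
foldr-/1 zero    g f g≡f = refl
foldr-/1 (suc L) g f g≡f = trans
  (cong₂ ℚ._+_ (g≡f 0 (s≤s z≤n))
    (foldr-/1 L (λ l → g (suc l)) (λ l → f (suc l)) λ l l<L → g≡f (suc l) (s≤s l<L)))
  (/1-homo-+ (f 0) _)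

-- The bound makes the truncated subtraction exact. If the congruence holds, the quotient is the
-- number of long blocks; if it fails, no tiling with `l` short blocks exists.
term≡closedTilings : ∀ m l → 3 * l ≤ 4 + m → term (4 + m) l ≡ + closedTilings m l ℚ./ 1
term≡closedTilings m l 3l≤n with (4 + m ∸ 3 * l) % 4 ≟ 0
... | yes p = fraction-product (4 + m) (den (4 + m) l C l) (closedTilings m l) (den (4 + m) l)
                {{den-nonZero (4 + m) l p}} (closedTilings-size m l q (begin
    4 + m                              ≡⟨ m+[n∸m]≡n 3l≤n ⟨
    3 * l + (4 + m ∸ 3 * l)            ≡⟨ cong (λ s → 3 * l + s) (m≡m%n+[m/n]*n (4 + m ∸ 3 * l) 4) ⟩
    3 * l + ((4 + m ∸ 3 * l) % 4 + q * 4) ≡⟨ cong (λ r → 3 * l + (r + q * 4)) p ⟩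
    3 * l + q * 4                      ≡⟨ cong (λ s → 3 * l + s) (*-comm q 4) ⟩
    3 * l + 4 * q                      ≡⟨ size≡ l q ⟨
    size l q                           ∎))
  where
  open ≡-Reasoning
  q = (4 + m ∸ 3 * l) ℕ./ 4
... | no ¬p with closedTilings-support m l
...   | inj₁ ≡0       = cong (λ s → + s ℚ./ 1) (sym ≡0)
...   | inj₂ (q , eq) = contradiction (begin
    (4 + m ∸ 3 * l) % 4          ≡⟨ cong (λ n → (n ∸ 3 * l) % 4) (trans eq (size≡ l q)) ⟩
    (3 * l + 4 * q ∸ 3 * l) % 4  ≡⟨ cong (_% 4) (m+n∸m≡n (3 * l) (4 * q)) ⟩
    4 * q % 4                    ≡⟨ cong (_% 4) (*-comm 4 q) ⟩
    q * 4 % 4                    ≡⟨ m*n%n≡0 q 4 ⟩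
    0                            ∎) ¬p
  where open ≡-Reasoning

formula≡closedWalks : ∀ m → formula (4 + m) ≡ + closedWalks (4 + m) ℚ./ 1
formula≡closedWalks m = trans (cong (foldr ℚ._+_ 0ℚ) (map-upTo (term n) (suc L))) (trans
  (foldr-/1 (suc L) (term n) (closedTilings m) λ l l≤L → term≡closedTilings m l (in-range l≤L))
  (cong (λ s → + s ℚ./ 1) (∑-closedTilings m L m<3*[1+L] 1+m<3*L)))
  where
  open ≤-Reasoning
  n = 4 + m
  L = n ℕ./ 3
  in-range : ∀ {l} → l < suc L → 3 * l ≤ n
  in-range {l} (s≤s l≤L) = begin
    3 * l ≤⟨ *-monoʳ-≤ 3 l≤L ⟩
    3 * L ≡⟨ *-comm 3 L ⟩
    L * 3 ≤⟨ m/n*n≤m n 3 ⟩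
    n     ∎
  1+m<3*L : suc m < 3 * L
  1+m<3*L = 3+m<3*[1+n]⇒m<3*n (suc m) L (begin-strict
    n               ≡⟨ m≡m%n+[m/n]*n n 3 ⟩
    n % 3 + L * 3   <⟨ +-monoˡ-< (L * 3) (m%n<n n 3) ⟩
    3 + L * 3       ≡⟨ *-comm (suc L) 3 ⟩
    3 * suc L       ∎)
  m<3*[1+L] : m < 3 * suc L
  m<3*[1+L] = begin-strict
    m         ≤⟨ n≤1+n m ⟩
    suc m     <⟨ 1+m<3*L ⟩
    3 * L     ≤⟨ *-monoʳ-≤ 3 (n≤1+n L) ⟩
    3 * suc L ∎

-- Directions carried by a label

data UFwd : Label → Set where
  fb : UFwd fb
  ff : UFwd ff

data UBack : Label → Set where
  bf : UBack bf
  bb : UBack bb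

data VFwd : Label → Set where
  bf : VFwd bf
  ff : VFwd ff

data VBack : Label → Set where
  fb : VBack fb
  bb : VBack bb

module _ {n : ℕ} .{{_ : NonZero n}} where

  u-injective : ∀ {i j : Fin n} → u i ≡ u j → i ≡ j
  u-injective refl = refl

  v-injective : ∀ {i j : Fin n} → v i ≡ v j → i ≡ j
  v-injective refl = refl

  _≟ᵛ_ : (x y : Vertex n) → Dec (x ≡ y)
  u i ≟ᵛ u j = map′ (cong u) u-injective (i Fin.≟ j)
  u i ≟ᵛ v j = no λ ()
  v i ≟ᵛ u j = no λ ()
  v i ≟ᵛ v j = map′ (cong v) v-injective (i Fin.≟ j)

  -- Arithmetic of indices modulo n

  infixl 6 _⊕_
  _⊕_ : Fin n → ℕ → Fin n
  i ⊕ k = (toℕ i + k) mod n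

  toℕ-mod : ∀ k → toℕ (k mod n) ≡ k % n
  toℕ-mod k = toℕ-fromℕ< (m%n<n k n)

  mod-≡ : ∀ {k l} → k % n ≡ l % n → k mod n ≡ l mod n
  mod-≡ {k} {l} eq = toℕ-injective (trans (toℕ-mod k) (trans eq (sym (toℕ-mod l))))

  toℕ-% : ∀ (i : Fin n) → toℕ i % n ≡ toℕ i
  toℕ-% i = m<n⇒m%n≡m (toℕ<n i)

  mod-toℕ : ∀ (i : Fin n) → toℕ i mod n ≡ i
  mod-toℕ i = toℕ-injective (trans (toℕ-mod (toℕ i)) (toℕ-% i))

  mod-⊕ : ∀ k l → k mod n ⊕ l ≡ (k + l) mod n
  mod-⊕ k l = mod-≡ (begin
    (toℕ (k mod n) + l) % n    ≡⟨ cong (λ r → (r + l) % n) (toℕ-mod k) ⟩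
    (k % n + l) % n            ≡⟨ %-distribˡ-+ (k % n) l n ⟩
    (k % n % n + l % n) % n    ≡⟨ cong (λ r → (r + l % n) % n) (m%n%n≡m%n k n) ⟩
    (k % n + l % n) % n        ≡⟨ %-distribˡ-+ k l n ⟨
    (k + l) % n                ∎)
    where open ≡-Reasoning

  ⊕-⊕ : ∀ i k l → i ⊕ k ⊕ l ≡ i ⊕ (k + l)
  ⊕-⊕ i k l = trans (mod-⊕ (toℕ i + k) l) (cong (_mod n) (+-assoc (toℕ i) k l))

  ⊕-⊕′ : ∀ i k l → i ⊕ k ⊕ l ≡ i ⊕ (l + k)
  ⊕-⊕′ i k l = trans (⊕-⊕ i k l) (cong (i ⊕_) (+-comm k l))

  ⊕-0 : ∀ i → i ⊕ 0 ≡ i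
  ⊕-0 i = trans (cong (_mod n) (+-identityʳ (toℕ i))) (mod-toℕ i)

  ⊕-n : ∀ i → i ⊕ n ≡ i
  ⊕-n i = trans (mod-≡ ([m+n]%n≡m%n (toℕ i) n)) (mod-toℕ i)

  -- `_⊕ (n ∸ k)` serves as subtraction of `k` modulo `n`.
  ⊕-return : ∀ i {k} → k ≤ n → i ⊕ k ⊕ (n ∸ k) ≡ i
  ⊕-return i {k} k≤n = trans (⊕-⊕ i k (n ∸ k)) (trans (cong (i ⊕_) (m+[n∸m]≡n k≤n)) (⊕-n i))

  ⊕-return′ : ∀ i {k} → k ≤ n → i ⊕ (n ∸ k) ⊕ k ≡ i
  ⊕-return′ i {k} k≤n = trans (⊕-⊕ i (n ∸ k) k) (trans (cong (i ⊕_) (m∸n+n≡m k≤n)) (⊕-n i))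

  i⊕k≡i⇒n∣k : ∀ i k → i ⊕ k ≡ i → n ∣ k
  i⊕k≡i⇒n∣k i k eq = divides q (+-cancelˡ-≡ (toℕ i) k (q * n) (begin
    toℕ i + k                  ≡⟨ m≡m%n+[m/n]*n (toℕ i + k) n ⟩
    (toℕ i + k) % n + q * n    ≡⟨ cong (_+ q * n) (trans (sym (toℕ-mod (toℕ i + k))) (cong toℕ eq)) ⟩
    toℕ i + q * n              ∎))
    where
    open ≡-Reasoning
    q = (toℕ i + k) ℕ./ n

  reachable : ∀ i j → ∃[ k ] k < n × i ⊕ k ≡ j
  reachable i j = k % n , m%n<n k n , (begin
    i ⊕ (k % n)      ≡⟨ mod-≡ (trans (cong (_% n) (+-comm (toℕ i) (k % n)))
                          (trans (sym (cong (λ r → (r + toℕ i) % n) (toℕ-mod k)))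
                                 (trans (sym (toℕ-mod _)) (trans (cong toℕ (mod-⊕ k (toℕ i))) (toℕ-mod _))))) ⟩
    (k + toℕ i) mod n ≡⟨ cong (_mod n) (trans (+-assoc (toℕ j) (n ∸ toℕ i) (toℕ i))
                          (cong (λ k → toℕ j + k) (m∸n+n≡m (<⇒≤ (toℕ<n i))))) ⟩
    j ⊕ n            ≡⟨ ⊕-n j ⟩
    j                ∎)
    where
    open ≡-Reasoning
    k = toℕ j + (n ∸ toℕ i)

  -- Perfect matchings and labellings

  uMate vMate : Label → Fin n → Vertex n
  uMate sp i = v i
  uMate bf i = u (i ⊕ (n ∸ 2))
  uMate fb i = u (i ⊕ 2)
  uMate ff i = u (i ⊕ 2)
  uMate bb i = u (i ⊕ (n ∸ 2))
  vMate sp i = u i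
  vMate bf i = v (i ⊕ 1)
  vMate fb i = v (i ⊕ (n ∸ 1))
  vMate ff i = v (i ⊕ 1)
  vMate bb i = v (i ⊕ (n ∸ 1))

  mate : (Fin n → Label) → Vertex n → Vertex n
  mate g (u i) = uMate (g i) i
  mate g (v i) = vMate (g i) i

  -- As the graph of a function it covers each vertex exactly once for any `g`; symmetry says that
  -- `mate g` is an involution, and this is what `Compatible` supplies.
  Matching : (Fin n → Label) → Rel (Vertex n) 0ℓ
  Matching g x y = mate g x ≡ y

  uMate-fwd : ∀ {x i} → UFwd x → uMate x i ≡ u (i ⊕ 2)
  uMate-fwd fb = refl
  uMate-fwd ff = refl

  uMate-back : ∀ {x i} → UBack x → uMate x i ≡ u (i ⊕ (n ∸ 2))
  uMate-back bf = refl
  uMate-back bb = refl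

  vMate-fwd : ∀ {x i} → VFwd x → vMate x i ≡ v (i ⊕ 1)
  vMate-fwd bf = refl
  vMate-fwd ff = refl

  vMate-back : ∀ {x i} → VBack x → vMate x i ≡ v (i ⊕ (n ∸ 1))
  vMate-back fb = refl
  vMate-back bb = refl

  uMate≡v⇒sp : ∀ {x i j} → uMate x i ≡ v j → x ≡ sp
  uMate≡v⇒sp {sp} _ = refl

  -- The two ends of each outer and inner edge agree on whether it is chosen. Spokes impose no
  -- condition, since both ends read the same label.
  record Compatible (g : Fin n → Label) : Set where
    field
      u→ : ∀ i → UFwd (g i) → UBack (g (i ⊕ 2))
      u← : ∀ i → UBack (g (i ⊕ 2)) → UFwd (g i)
      v→ : ∀ i → VFwd (g i) → VBack (g (i ⊕ 1))
      v← : ∀ i → VBack (g (i ⊕ 1)) → VFwd (g i)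

  module _ (n≥3 : 3 ≤ n) where

    2≤n : 2 ≤ n
    2≤n = ≤-trans (n≤1+n 2) n≥3

    1≤n : 1 ≤ n
    1≤n = ≤-trans (n≤1+n 1) 2≤n

    mate-involutive : ∀ {g} → Compatible g → ∀ x → mate g (mate g x) ≡ x
    mate-involutive {g} c = λ { (u i) → atU i _ refl ; (v i) → atV i _ refl }
      where
      open Compatible c
      u-fwd : ∀ i → UFwd (g i) → mate g (uMate (g i) i) ≡ u i
      u-fwd i h = trans (cong (mate g) (uMate-fwd h))
        (trans (uMate-back (u→ i h)) (cong u (⊕-return i 2≤n)))
      u-back : ∀ i → UBack (g i) → mate g (uMate (g i) i) ≡ u i
      u-back i h = trans (cong (mate g) (uMate-back h))
        (trans (uMate-fwd (u← (i ⊕ (n ∸ 2)) (subst (λ j → UBack (g j)) (sym (⊕-return′ i 2≤n)) h)))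
               (cong u (⊕-return′ i 2≤n)))
      v-fwd : ∀ i → VFwd (g i) → mate g (vMate (g i) i) ≡ v i
      v-fwd i h = trans (cong (mate g) (vMate-fwd h))
        (trans (vMate-back (v→ i h)) (cong v (⊕-return i 1≤n)))
      v-back : ∀ i → VBack (g i) → mate g (vMate (g i) i) ≡ v i
      v-back i h = trans (cong (mate g) (vMate-back h))
        (trans (vMate-fwd (v← (i ⊕ (n ∸ 1)) (subst (λ j → VBack (g j)) (sym (⊕-return′ i 1≤n)) h)))
               (cong v (⊕-return′ i 1≤n)))
      atU : ∀ i x → g i ≡ x → mate g (uMate (g i) i) ≡ u i
      atU i sp eq = trans (cong (λ x → mate g (uMate x i)) eq) (cong (λ x → vMate x i) eq)
      atU i bf eq = u-back i (subst UBack (sym eq) bf)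
      atU i fb eq = u-fwd i (subst UFwd (sym eq) fb)
      atU i ff eq = u-fwd i (subst UFwd (sym eq) ff)
      atU i bb eq = u-back i (subst UBack (sym eq) bb)
      atV : ∀ i x → g i ≡ x → mate g (vMate (g i) i) ≡ v i
      atV i sp eq = trans (cong (λ x → mate g (vMate x i)) eq) (cong (λ x → uMate x i) eq)
      atV i bf eq = v-fwd i (subst VFwd (sym eq) bf)
      atV i fb eq = v-back i (subst VBack (sym eq) fb)
      atV i ff eq = v-fwd i (subst VFwd (sym eq) ff)
      atV i bb eq = v-back i (subst VBack (sym eq) bb)

    uMate-adjacent : ∀ x i → P n (u i) (uMate x i)
    uMate-adjacent sp i = fwd (spoke i)
    uMate-adjacent bf i = bwd (subst (λ j → Edge n (u (i ⊕ (n ∸ 2))) (u j)) (⊕-return′ i 2≤n) (outer _))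
    uMate-adjacent fb i = fwd (outer i)
    uMate-adjacent ff i = fwd (outer i)
    uMate-adjacent bb i = uMate-adjacent bf i

    vMate-adjacent : ∀ x i → P n (v i) (vMate x i)
    vMate-adjacent sp i = bwd (spoke i)
    vMate-adjacent bf i = fwd (inner i)
    vMate-adjacent fb i = bwd (subst (λ j → Edge n (v (i ⊕ (n ∸ 1))) (v j)) (⊕-return′ i 1≤n) (inner _))
    vMate-adjacent ff i = fwd (inner i)
    vMate-adjacent bb i = vMate-adjacent fb i

    mate-adjacent : ∀ g x → P n x (mate g x)
    mate-adjacent g (u i) = uMate-adjacent (g i) i
    mate-adjacent g (v i) = vMate-adjacent (g i) i

    Matching-perfect : ∀ {g} → Compatible g → IsPerfectMatching (P n) (Matching g)
    Matching-perfect {g} c = record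
      { M-sym    = λ { {x} refl → mate-involutive c x }
      ; M⊆Adj    = λ { {x} refl → mate-adjacent g x }
      ; covered! = λ x → mate g x , refl , λ eq → eq
      }

    predecessor : ∀ {k i j} → k ≤ n → j ⊕ k ≡ i → j ≡ i ⊕ (n ∸ k)
    predecessor {k} {i} {j} k≤n eq = trans (sym (⊕-return j k≤n)) (cong (_⊕ (n ∸ k)) eq)

    edge-to-u : ∀ {x y i} → Edge n y x → x ≡ u i → y ≡ u (i ⊕ (n ∸ 2))
    edge-to-u (outer j) eq = cong u (predecessor 2≤n (u-injective eq))

    edge-to-v : ∀ {x y i} → Edge n y x → x ≡ v i → y ≡ u i ⊎ y ≡ v (i ⊕ (n ∸ 1))
    edge-to-v (spoke j) eq = inj₁ (cong u (v-injective eq))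
    edge-to-v (inner j) eq = inj₂ (cong v (predecessor 1≤n (v-injective eq)))

    -- No spoke and no forward edge is read as a back edge; `u-back` and `v-back` justify this
    -- default by covering.
    fromDirections : (spoke? uFwd? vFwd? : Bool) → Label
    fromDirections true  _     _     = sp
    fromDirections false true  true  = ff
    fromDirections false true  false = fb
    fromDirections false false true  = bf
    fromDirections false false false = bb

    module Labelling {M : Rel (Vertex n) 0ℓ} (pm : IsPerfectMatching (P n) M) where
      open IsPerfectMatching pm

      -- An arbitrary relation becomes decidable here because unique existence hands over the mate
      -- of `x`, to be compared with `y`.
      M? : ∀ x y → Dec (M x y)
      M? x y with covered! x
      ... | z , Mxz , unique = map′ (λ { refl → Mxz }) unique (z ≟ᵛ y)

      labelling : Fin n → Label
      labelling i = fromDirections (does (M? (u i) (v i)))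
                                   (does (M? (u i) (u (i ⊕ 2))))
                                   (does (M? (v i) (v (i ⊕ 1))))

      u-back : ∀ i → ¬ M (u i) (v i) → ¬ M (u i) (u (i ⊕ 2)) → M (u i) (u (i ⊕ (n ∸ 2)))
      u-back i ¬s ¬f with covered! (u i)
      ... | y , Mxy , _ with M⊆Adj Mxy
      ...   | fwd (outer .i) = contradiction Mxy ¬f
      ...   | fwd (spoke .i) = contradiction Mxy ¬s
      ...   | bwd e = subst (M (u i)) (edge-to-u e refl) Mxy

      v-back : ∀ i → ¬ M (u i) (v i) → ¬ M (v i) (v (i ⊕ 1)) → M (v i) (v (i ⊕ (n ∸ 1)))
      v-back i ¬s ¬f with covered! (v i)
      ... | y , Mxy , _ with M⊆Adj Mxy
      ...   | fwd (inner .i) = contradiction Mxy ¬f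
      ...   | bwd e with edge-to-v e refl
      ...     | inj₁ refl = contradiction (M-sym Mxy) ¬s
      ...     | inj₂ eq   = subst (M (v i)) eq Mxy

      M-mate : ∀ x → M x (mate labelling x)
      -- The three decisions become arguments, so that matching on them reduces `fromDirections`.
      M-mate (u i) = go (M? (u i) (v i)) (M? (u i) (u (i ⊕ 2))) (M? (v i) (v (i ⊕ 1)))
        where
        go : (s? : Dec (M (u i) (v i))) (f? : Dec (M (u i) (u (i ⊕ 2)))) (f′? : Dec (M (v i) (v (i ⊕ 1)))) →
             M (u i) (uMate (fromDirections (does s?) (does f?) (does f′?)) i)
        go (yes s) _       _       = s
        go (no ¬s) (yes f) (yes _) = f
        go (no ¬s) (yes f) (no  _) = f
        go (no ¬s) (no ¬f) (yes _) = u-back i ¬s ¬f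
        go (no ¬s) (no ¬f) (no  _) = u-back i ¬s ¬f
      M-mate (v i) = go (M? (u i) (v i)) (M? (u i) (u (i ⊕ 2))) (M? (v i) (v (i ⊕ 1)))
        where
        go : (s? : Dec (M (u i) (v i))) (f? : Dec (M (u i) (u (i ⊕ 2)))) (f′? : Dec (M (v i) (v (i ⊕ 1)))) →
             M (v i) (vMate (fromDirections (does s?) (does f?) (does f′?)) i)
        go (yes s) _       _       = M-sym s
        go (no ¬s) (yes _) (yes f) = f
        go (no ¬s) (yes _) (no ¬f) = v-back i ¬s ¬f
        go (no ¬s) (no  _) (yes f) = f
        go (no ¬s) (no  _) (no ¬f) = v-back i ¬s ¬f

      mate-unique : ∀ {x y} → M x y → mate labelling x ≡ y
      mate-unique {x} Mxy with covered! x
      ... | z , _ , unique = trans (sym (unique (M-mate x))) (unique Mxy)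

      labelling-involutive : ∀ x → mate labelling (mate labelling x) ≡ x
      labelling-involutive x = mate-unique (M-sym (M-mate x))

    module _ (n≢4 : n ≢ 4) where

      n∤4 : ¬ n ∣ 4
      n∤4 n∣4 with m≤n⇒m<n∨m≡n n≥3
      ... | inj₁ n>3  = n≢4 (≤-antisym (∣⇒≤ n∣4) n>3)
      ... | inj₂ refl with divides (suc zero) () ← n∣4

      n∤2 : ¬ n ∣ 2
      n∤2 n∣2 = contradiction (≤-trans n≥3 (∣⇒≤ n∣2)) λ { (s≤s (s≤s ())) }

      -- Equality would make `n` divide 4. With `n ≥ 3` this singles out `n = 4`, the length at
      -- which the direction of an outer edge is ambiguous.
      u-fwd≢back : ∀ i → i ⊕ 2 ≢ i ⊕ (n ∸ 2)
      u-fwd≢back i eq = n∤4 (i⊕k≡i⇒n∣k i 4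
        (trans (sym (⊕-⊕ i 2 2)) (trans (cong (_⊕ 2) eq) (⊕-return′ i 2≤n))))

      v-fwd≢back : ∀ i → i ⊕ 1 ≢ i ⊕ (n ∸ 1)
      v-fwd≢back i eq = n∤2 (i⊕k≡i⇒n∣k i 2
        (trans (sym (⊕-⊕ i 1 1)) (trans (cong (_⊕ 1) eq) (⊕-return′ i 1≤n))))

      uMate≡fwd⇒UFwd : ∀ {x i} → uMate x i ≡ u (i ⊕ 2) → UFwd x
      uMate≡fwd⇒UFwd {bf} {i} eq = contradiction (sym (u-injective eq)) (u-fwd≢back i)
      uMate≡fwd⇒UFwd {fb} {i} eq = fb
      uMate≡fwd⇒UFwd {ff} {i} eq = ff
      uMate≡fwd⇒UFwd {bb} {i} eq = contradiction (sym (u-injective eq)) (u-fwd≢back i)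

      uMate≡back⇒UBack : ∀ {x i} → uMate x i ≡ u (i ⊕ (n ∸ 2)) → UBack x
      uMate≡back⇒UBack {bf} {i} eq = bf
      uMate≡back⇒UBack {fb} {i} eq = contradiction (u-injective eq) (u-fwd≢back i)
      uMate≡back⇒UBack {ff} {i} eq = contradiction (u-injective eq) (u-fwd≢back i)
      uMate≡back⇒UBack {bb} {i} eq = bb

      vMate≡fwd⇒VFwd : ∀ {x i} → vMate x i ≡ v (i ⊕ 1) → VFwd x
      vMate≡fwd⇒VFwd {bf} {i} eq = bf
      vMate≡fwd⇒VFwd {fb} {i} eq = contradiction (sym (v-injective eq)) (v-fwd≢back i)
      vMate≡fwd⇒VFwd {ff} {i} eq = ff
      vMate≡fwd⇒VFwd {bb} {i} eq = contradiction (sym (v-injective eq)) (v-fwd≢back i)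

      vMate≡back⇒VBack : ∀ {x i} → vMate x i ≡ v (i ⊕ (n ∸ 1)) → VBack x
      vMate≡back⇒VBack {bf} {i} eq = contradiction (v-injective eq) (v-fwd≢back i)
      vMate≡back⇒VBack {fb} {i} eq = fb
      vMate≡back⇒VBack {ff} {i} eq = contradiction (v-injective eq) (v-fwd≢back i)
      vMate≡back⇒VBack {bb} {i} eq = bb

      mates-injective : ∀ {x y} i → uMate x i ≡ uMate y i → vMate x i ≡ vMate y i → x ≡ y
      mates-injective {sp} {y} i eu ev = sym (uMate≡v⇒sp (sym eu))
      mates-injective {bf} {y} i eu ev with uMate≡back⇒UBack {y} (sym eu) | vMate≡fwd⇒VFwd {y} (sym ev)
      ... | bf | bf = refl
      mates-injective {fb} {y} i eu ev with uMate≡fwd⇒UFwd {y} (sym eu) | vMate≡back⇒VBack {y} (sym ev)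
      ... | fb | fb = refl
      mates-injective {ff} {y} i eu ev with uMate≡fwd⇒UFwd {y} (sym eu) | vMate≡fwd⇒VFwd {y} (sym ev)
      ... | ff | ff = refl
      mates-injective {bb} {y} i eu ev with uMate≡back⇒UBack {y} (sym eu) | vMate≡back⇒VBack {y} (sym ev)
      ... | bb | bb = refl

      mate-injective : ∀ {g h} → (∀ x → mate g x ≡ mate h x) → ∀ i → g i ≡ h i
      mate-injective eq i = mates-injective i (eq (u i)) (eq (v i))

      involutive⇒Compatible : ∀ {g} → (∀ x → mate g (mate g x) ≡ x) → Compatible g
      involutive⇒Compatible {g} inv = record
        { u→ = λ i h → uMate≡back⇒UBack (trans (flip (uMate-fwd h)) (cong u (sym (⊕-return i 2≤n))))
        ; u← = λ i h → uMate≡fwd⇒UFwd (flip (trans (uMate-back h) (cong u (⊕-return i 2≤n))))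
        ; v→ = λ i h → vMate≡back⇒VBack (trans (flip (vMate-fwd h)) (cong v (sym (⊕-return i 1≤n))))
        ; v← = λ i h → vMate≡fwd⇒VFwd (flip (trans (vMate-back h) (cong v (⊕-return i 1≤n))))
        }
        where
        flip : ∀ {x y} → mate g x ≡ y → mate g y ≡ x
        flip {x} eq = trans (cong (mate g) (sym eq)) (inv x)

-- Sequences of labels

-- `Compatible` unrolled along the natural numbers, so that runs of labels can be followed without
-- arithmetic modulo `n`.
record Local (f : ℕ → Label) : Set where
  field
    u→ : ∀ k → UFwd (f k) → UBack (f (2 + k))
    u← : ∀ k → UBack (f (2 + k)) → UFwd (f k)
    v→ : ∀ k → VFwd (f k) → VBack (f (1 + k))
    v← : ∀ k → VBack (f (1 + k)) → VFwd (f k)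

module _ {f : ℕ → Label} (local : Local f) where
  open Local local

  -- The outer direction at `2 + k` is governed by `f k`, the inner one by `f (1 + k)`. After `bf`,
  -- `fb` this leaves `sp` and `ff`, both of which are steps.
  next-step : ∀ k → (f (1 + k) ≡ sp → f (2 + k) ≡ bf) →
              Step (f k) (f (1 + k)) → Step (f (1 + k)) (f (2 + k))
  next-step k after-sp = go (u→ k) (u← k) (v→ (1 + k)) (v← (1 + k)) after-sp
    where
    go : ∀ {x y z} → (UFwd x → UBack z) → (UBack z → UFwd x) →
         (VFwd y → VBack z) → (VBack z → VFwd y) → (y ≡ sp → z ≡ bf) →
         Step x y → Step y z
    go u→ u← v→ v← after-sp sp→bf with v→ bf
    ... | fb = bf→fb
    ... | bb with () ← u← bb
    go u→ u← v→ v← after-sp bb→bf with v→ bf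
    ... | fb = bf→fb
    ... | bb with () ← u← bb
    go {z = sp} u→ u← v→ v← after-sp bf→fb = fb→sp
    go {z = bf} u→ u← v→ v← after-sp bf→fb with () ← u← bf
    go {z = fb} u→ u← v→ v← after-sp bf→fb with () ← v← fb
    go {z = ff} u→ u← v→ v← after-sp bf→fb = fb→ff
    go {z = bb} u→ u← v→ v← after-sp bf→fb with () ← u← bb
    go u→ u← v→ v← after-sp fb→sp with refl ← after-sp refl = sp→bf
    go u→ u← v→ v← after-sp fb→ff with u→ fb | v→ ff
    ... | bb | bb = ff→bb
    go u→ u← v→ v← after-sp ff→bb with u→ ff
    ... | bf = bb→bf
    ... | bb with () ← v← bb

  steps-from : (∀ k → f k ≡ sp → f (1 + k) ≡ bf) → Step (f 0) (f 1) → ∀ k → Step (f k) (f (1 + k))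
  steps-from after-sp step zero    = step
  steps-from after-sp step (suc k) = next-step k (after-sp (suc k)) (steps-from after-sp step k)

  -- A spoke followed by ff forces ff fb bf bb ff fb bf bb ... up to the next
  -- spoke, which is therefore at a distance 1 (mod 4).
  no-later-spoke :
    (∀ d → f (suc d) ≡ sp → (∀ e → e < d → f (suc e) ≢ sp) → d % 4 ≡ 2) →
    f 0 ≡ sp → f 1 ≡ ff → ∀ d → f (suc d) ≢ sp
  no-later-spoke gap f0 f1 d = proj₂ (proj₂ (run d)) d (s≤s (m≤m*n d 4))
    where
    Block : ℕ → Set
    Block k = f (2 + k) ≡ fb × f (3 + k) ≡ bf × f (4 + k) ≡ bb × (f (5 + k) ≡ sp ⊎ f (5 + k) ≡ ff)

    toBlock : ∀ k → ¬ UFwd (f k) → f (1 + k) ≡ ff → Block k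
    toBlock k ¬u f1 = f2 , f3 , f4 , f5
      where
      second : ∀ {y z} → y ≡ ff → (VFwd y → VBack z) → ¬ UBack z → z ≡ fb
      second refl v→ ¬b with v→ ff
      ... | fb = refl
      ... | bb = contradiction bb ¬b
      f2 = second f1 (v→ (1 + k)) λ b → ¬u (u← k b)
      third : ∀ {x y z} → x ≡ ff → y ≡ fb → (UFwd x → UBack z) → (VBack z → VFwd y) → z ≡ bf
      third refl refl u→ v← with u→ ff
      ... | bf = refl
      ... | bb with () ← v← bb
      f3 = third f1 f2 (u→ (1 + k)) (v← (2 + k))
      fourth : ∀ {x y z} → x ≡ fb → y ≡ bf → (UFwd x → UBack z) → (VFwd y → VBack z) → z ≡ bb
      fourth refl refl u→ v→ with u→ fb | v→ bf
      ... | bb | bb = refl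
      f4 = fourth f2 f3 (u→ (2 + k)) (v→ (3 + k))
      fifth : ∀ {x y z} → x ≡ bf → y ≡ bb → (UBack z → UFwd x) → (VBack z → VFwd y) → z ≡ sp ⊎ z ≡ ff
      fifth {z = sp} refl refl u← v← = inj₁ refl
      fifth {z = bf} refl refl u← v← with () ← u← bf
      fifth {z = fb} refl refl u← v← with () ← v← fb
      fifth {z = ff} refl refl u← v← = inj₂ refl
      fifth {z = bb} refl refl u← v← with () ← u← bb
      f5 = fifth f3 f4 (u← (3 + k)) (v← (4 + k))

    ≢sp : ∀ {k x} → f k ≡ x → x ≢ sp → f k ≢ sp
    ≢sp refl x≢sp = x≢sp

    extend : ∀ {m} → (∀ d → d < m → f (suc d) ≢ sp) → f (suc m) ≢ sp → ∀ d → d < suc m → f (suc d) ≢ sp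
    extend {m} below at d (s≤s d≤m) with m≤n⇒m<n∨m≡n d≤m
    ... | inj₁ d<m  = below d d<m
    ... | inj₂ refl = at

    run : ∀ q → ¬ UFwd (f (q * 4)) × f (1 + q * 4) ≡ ff × (∀ d → d < 1 + q * 4 → f (suc d) ≢ sp)
    run zero = (λ h → contradiction (subst UFwd f0 h) λ ()) , f1 , extend (λ _ ()) (≢sp f1 λ ())
    run (suc q) with run q
    ... | ¬u , f1 , none with toBlock (q * 4) ¬u f1
    ...   | f2 , f3 , f4 , f5 with extend (extend (extend none (≢sp f2 λ ())) (≢sp f3 λ ())) (≢sp f4 λ ())
    ...     | none′ with f5
    ...       | inj₁ f5≡sp = contradiction (trans (sym (m*n%n≡0 (suc q) 4)) (gap (4 + q * 4) f5≡sp none′)) λ ()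
    ...       | inj₂ f5≡ff = (λ h → contradiction (subst UFwd f4 h) λ ()) , f5≡ff , extend none′ (≢sp f5≡ff λ ())

-- Gaps and periods along a sequence of steps

module _ {f : ℕ → Label} (step : ∀ k → Step (f k) (f (1 + k))) where

  after-sp : ∀ k → f k ≡ sp → f (1 + k) ≡ bf
  after-sp k eq with f k | f (1 + k) | step k
  after-sp k refl | .sp | .bf | sp→bf = refl

  after-bf : ∀ k → f k ≡ bf → f (1 + k) ≡ fb
  after-bf k eq with f k | f (1 + k) | step k
  after-bf k refl | .bf | .fb | bf→fb = refl

  after-fb : ∀ k → f k ≡ fb → f (1 + k) ≢ sp → f (1 + k) ≡ ff
  after-fb k eq ¬sp with f k | f (1 + k) | step k
  after-fb k refl ¬sp | .fb | .sp | fb→sp = contradiction refl ¬sp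
  after-fb k refl ¬sp | .fb | .ff | fb→ff = refl

  after-ff : ∀ k → f k ≡ ff → f (1 + k) ≡ bb
  after-ff k eq with f k | f (1 + k) | step k
  after-ff k refl | .ff | .bb | ff→bb = refl

  after-bb : ∀ k → f k ≡ bb → f (1 + k) ≡ bf
  after-bb k eq with f k | f (1 + k) | step k
  after-bb k refl | .bb | .bf | bb→bf = refl

  reach-fb : (∀ k → f k ≢ sp) → ∃[ k ] f k ≡ fb
  reach-fb ¬sp with f 0 in eq
  ... | sp = contradiction eq (¬sp 0)
  ... | bf = 1 , after-bf 0 eq
  ... | fb = 0 , eq
  ... | ff = 3 , after-bf 2 (after-bb 1 (after-ff 0 eq))
  ... | bb = 2 , after-bf 1 (after-bb 0 eq)

  period : f 0 ≡ fb → (∀ k → f k ≢ sp) → ∀ q → f (q * 4) ≡ fb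
  period f0 ¬sp zero    = f0
  period f0 ¬sp (suc q) =
    after-bf _ (after-bb _ (after-ff _ (after-fb (q * 4) (period f0 ¬sp q) (¬sp _))))

  -- Without spokes the walk is confined to the 4-cycle of the digraph. Applied to the return after
  -- `n` indices, this yields `4 ∣ n`.
  fb-return : f 0 ≡ fb → (∀ k → f k ≢ sp) → ∀ q r → r < 4 → f (r + q * 4) ≡ fb → r ≡ 0
  fb-return f0 ¬sp q 0 _ _ = refl
  fb-return f0 ¬sp q 1 _ eq
    with () ← trans (sym eq) (after-fb (q * 4) (period f0 ¬sp q) (¬sp _))
  fb-return f0 ¬sp q 2 _ eq
    with () ← trans (sym eq) (after-ff _ (after-fb (q * 4) (period f0 ¬sp q) (¬sp _)))
  fb-return f0 ¬sp q 3 _ eq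
    with () ← trans (sym eq) (after-bb _ (after-ff _ (after-fb (q * 4) (period f0 ¬sp q) (¬sp _))))
  fb-return f0 ¬sp q (suc (suc (suc (suc _)))) (s≤s (s≤s (s≤s (s≤s ())))) _

-- Between `fb` and the next spoke lie only whole blocks `ff bb bf fb`.
gap-from-fb : ∀ (f : ℕ → Label) → (∀ k → Step (f k) (f (1 + k))) → f 0 ≡ fb →
              ∀ d → f (suc d) ≡ sp → (∀ e → e < d → f (suc e) ≢ sp) → d % 4 ≡ 0
gap-from-fb f step f0 zero    eq none = refl
gap-from-fb f step f0 (suc d) eq none
  with f1 ← after-fb {f} step 0 f0 (none 0 (s≤s z≤n)) with f2 ← after-ff {f} step 1 f1 with d
... | zero with () ← trans (sym eq) f2
... | suc zero with () ← trans (sym eq) (after-bb {f} step 2 f2)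
... | suc (suc zero) with () ← trans (sym eq) (after-bf {f} step 3 (after-bb {f} step 2 f2))
... | suc (suc (suc d′)) = gap-from-fb (λ k → f (4 + k)) (λ k → step (4 + k)) (after-bf {f} step 3 (after-bb {f} step 2 f2)) d′ eq
                             λ e e<d′ → none (4 + e) (s≤s (s≤s (s≤s (s≤s e<d′))))

-- The indices `bf`, `fb` that complete the block of the spoke give the residue 2; the long blocks
-- after them contribute 0.
gap-from-sp : ∀ (f : ℕ → Label) → (∀ k → Step (f k) (f (1 + k))) → f 0 ≡ sp →
              ∀ d → f (suc d) ≡ sp → (∀ e → e < d → f (suc e) ≢ sp) → d % 4 ≡ 2
gap-from-sp f step f0 d eq none with f1 ← after-sp {f} step 0 f0 with f2 ← after-bf {f} step 1 f1 with d
... | zero with () ← trans (sym eq) f1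
... | suc zero with () ← trans (sym eq) f2
... | suc (suc d′) = begin
  (2 + d′) % 4          ≡⟨ %-distribˡ-+ 2 d′ 4 ⟩
  (2 + d′ % 4) % 4      ≡⟨ cong (λ r → (2 + r) % 4)
                             (gap-from-fb (λ k → f (2 + k)) (λ k → step (2 + k)) f2 d′ eq
                               λ e e<d′ → none (2 + e) (s≤s (s≤s e<d′))) ⟩
  2                     ∎
  where open ≡-Reasoning

-- Labellings of the cycle whose neighbours form steps

Step²-u→ : ∀ {x y z} → Step x y → Step y z → UFwd x → UBack z
Step²-u→ fb→sp sp→bf fb = bf
Step²-u→ fb→ff ff→bb fb = bb
Step²-u→ ff→bb bb→bf ff = bf

Step²-u← : ∀ {x y z} → Step x y → Step y z → UBack z → UFwd x
Step²-u← fb→sp sp→bf bf = fb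
Step²-u← fb→ff ff→bb bb = fb
Step²-u← ff→bb bb→bf bf = ff

Step-v→ : ∀ {x y} → Step x y → VFwd x → VBack y
Step-v→ bf→fb bf = fb
Step-v→ ff→bb ff = bb

Step-v← : ∀ {x y} → Step x y → VBack y → VFwd x
Step-v← bf→fb fb = bf
Step-v← ff→bb bb = ff

module _ {n : ℕ} .{{_ : NonZero n}} where

  Stepwise : (Fin n → Label) → Set
  Stepwise g = ∀ i → Step (g i) (g (i ⊕ 1))

  Stepwise⇒Compatible : ∀ {g} → Stepwise g → Compatible g
  Stepwise⇒Compatible {g} step = record
    { u→ = λ i → Step²-u→ (step i) (step′ i)
    ; u← = λ i → Step²-u← (step i) (step′ i)
    ; v→ = λ i → Step-v→ (step i)
    ; v← = λ i → Step-v← (step i)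
    }
    where
    step′ : ∀ i → Step (g (i ⊕ 1)) (g (i ⊕ 2))
    step′ i = subst (λ j → Step (g (i ⊕ 1)) (g j)) (⊕-⊕ i 1 1) (step (i ⊕ 1))

  Stepwise-along : ∀ {g} → Stepwise g → ∀ i k → Step (g (i ⊕ k)) (g (i ⊕ (1 + k)))
  Stepwise-along {g} step i k =
    subst (λ j → Step (g (i ⊕ k)) (g j)) (⊕-⊕′ i k 1) (step (i ⊕ k))

  Compatible-along : ∀ {g} → Compatible g → ∀ i → Local (λ k → g (i ⊕ k))
  Compatible-along {g} c i = record
    { u→ = λ k h → subst (λ j → UBack (g j)) (⊕-⊕′ i k 2) (u→ (i ⊕ k) h)
    ; u← = λ k h → u← (i ⊕ k) (subst (λ j → UBack (g j)) (sym (⊕-⊕′ i k 2)) h)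
    ; v→ = λ k h → subst (λ j → VBack (g j)) (⊕-⊕′ i k 1) (v→ (i ⊕ k) h)
    ; v← = λ k h → v← (i ⊕ k) (subst (λ j → VBack (g j)) (sym (⊕-⊕′ i k 1)) h)
    }
    where open Compatible c

  -- Every index is reached from `i` by going forward, so a single step starts the induction for the
  -- whole cycle.
  spread : ∀ {g} → Compatible g → (∀ i → g i ≡ sp → g (i ⊕ 1) ≡ bf) →
           ∀ i → Step (g i) (g (i ⊕ 1)) → Stepwise g
  spread {g} c after-sp i step j with reachable i j
  ... | k , _ , refl = subst (λ j → Step (g (i ⊕ k)) (g j)) (sym (⊕-⊕′ i k 1))
    (steps-from (Compatible-along c i)
      (λ k eq → trans (cong g (sym (⊕-⊕′ i k 1))) (after-sp (i ⊕ k) eq))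
      (subst (λ j → Step (g j) (g (i ⊕ 1))) (sym (⊕-0 i)) step) k)

  -- Type (i) matchings

  -- The gap condition with the number `d` of indices strictly between as the variable, in place of
  -- a truncated difference.
  Gaps : (Fin n → Label) → Set
  Gaps g = ∀ i d → g i ≡ sp → g (i ⊕ suc d) ≡ sp →
           (∀ e → e < d → g (i ⊕ suc e) ≢ sp) → d % 4 ≡ 2

  Stepwise⇒Gaps : ∀ {g} → Stepwise g → Gaps g
  Stepwise⇒Gaps {g} step i d eq = gap-from-sp (λ k → g (i ⊕ k)) (Stepwise-along step i)
    (trans (cong g (⊕-0 i)) eq) d

  Gaps⇒Stepwise : ∀ {g} → Compatible g → Gaps g → ∀ i → g i ≡ sp → Stepwise g
  Gaps⇒Stepwise {g} c gaps i₀ eq₀ =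
    spread c after-spoke i₀ (subst₂ Step (sym eq₀) (sym (after-spoke i₀ eq₀)) sp→bf)
    where
    open Compatible c
    after-spoke : ∀ i → g i ≡ sp → g (i ⊕ 1) ≡ bf
    after-spoke i eq with g (i ⊕ 1) in eq₁
    ... | sp with () ← gaps i 0 eq eq₁ (λ _ ())
    ... | bf = refl
    ... | fb with () ← subst VFwd eq (v← i (subst VBack (sym eq₁) fb))
    -- Going once around meets the spoke at `i` again, at distance `suc (pred n)`, whereas a run
    -- that begins with `ff` never meets a spoke.
    ... | ff = contradiction (trans (cong g (trans (cong (i ⊕_) (suc-pred n)) (⊕-n i))) eq)
      (no-later-spoke (Compatible-along c i) (λ d → gaps i d eq) (trans (cong g (⊕-0 i)) eq) eq₁ (pred n))
    ... | bb with () ← subst VFwd eq (v← i (subst VBack (sym eq₁) bb))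

  module _ {M : Rel (Vertex n) 0ℓ} {g : Fin n → Label}
           (spoke⇒sp : ∀ i → M (u i) (v i) → g i ≡ sp)
           (sp⇒spoke : ∀ i → g i ≡ sp → M (u i) (v i)) where

    TypeI⇒Gaps : TypeI n M → Gaps g
    TypeI⇒Gaps (_ , gap) i d g-i g-j none =
      trans (cong (λ k → (k ∸ 1) % 4) (sym (m+n∸m≡n (toℕ i) (suc d)))) (gap i (toℕ i + suc d) record
        { i<j          = subst (_≤ toℕ i + suc d) (+-comm (toℕ i) 1) (+-monoʳ-≤ (toℕ i) (s≤s z≤n))
        ; j≤i+n        = +-monoʳ-≤ (toℕ i) (≮⇒≥ n≮1+d)
        ; spoke-i      = sp⇒spoke (toℕ i mod n) (trans (cong g (mod-toℕ i)) g-i)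
        ; spoke-j      = sp⇒spoke (i ⊕ suc d) g-j
        ; none-between = none-between
        })
      where
      -- Otherwise the spoke at `i` itself, returning after `n` indices, would lie strictly between.
      n≮1+d : ¬ n < suc d
      n≮1+d (s≤s n≤d) = none (pred n) (subst (_≤ d) (sym (suc-pred n)) n≤d)
        (trans (cong g (trans (cong (i ⊕_) (suc-pred n)) (⊕-n i))) g-i)
      none-between : ∀ k → toℕ i < k → k < toℕ i + suc d → ¬ Spoke n M k
      none-between k i<k k<j with m≤n⇒∃[o]m+o≡n i<k
      ... | e , refl = λ s → none e
        (+-cancelˡ-< (toℕ i) e d (s≤s⁻¹ (subst (suc (toℕ i + e) <_) (+-suc (toℕ i) d) k<j)))
        (trans (cong (λ k → g (k mod n)) (+-suc (toℕ i) e)) (spoke⇒sp _ s))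

    Gaps⇒TypeI : ∀ i → g i ≡ sp → Gaps g → TypeI n M
    Gaps⇒TypeI i₀ eq₀ gaps = (i₀ , sp⇒spoke i₀ eq₀) , gap
      where
      gap : ∀ i j → Consecutive n M (toℕ i) j → (j ∸ toℕ i ∸ 1) % 4 ≡ 2
      gap i j con with m≤n⇒∃[o]m+o≡n (Consecutive.i<j con)
      ... | d , refl = trans
        (cong (λ k → (k ∸ 1) % 4) (trans (cong (_∸ toℕ i) (sym (+-suc (toℕ i) d))) (m+n∸m≡n (toℕ i) (suc d))))
        (gaps i d (trans (cong g (sym (mod-toℕ i))) (spoke⇒sp _ spoke-i))
          (trans (cong (λ k → g (k mod n)) (+-suc (toℕ i) d)) (spoke⇒sp _ spoke-j))
          λ e e<d eq → none-between (suc (toℕ i + e)) (s≤s (m≤m+n (toℕ i) e)) (s≤s (+-monoʳ-< (toℕ i) e<d))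
            (sp⇒spoke _ (trans (cong (λ k → g (k mod n)) (sym (+-suc (toℕ i) e))) eq)))
        where open Consecutive con

  -- Type (ii) matchings

  Stepwise⇒4∣n : ∀ {g} → Stepwise g → (∀ i → g i ≢ sp) → ∀ i → g i ≡ fb → 4 ∣ n
  Stepwise⇒4∣n {g} step ¬sp i eq = m%n≡0⇒n∣m n 4
    (fb-return (Stepwise-along step i) (trans (cong g (⊕-0 i)) eq) (λ k → ¬sp (i ⊕ k)) (n ℕ./ 4) (n % 4)
      (m%n<n n 4)
      (trans (cong g (trans (cong (i ⊕_) (sym (m≡m%n+[m/n]*n n 4))) (⊕-n i))) eq))

  quotient-bound : 4 ∣ n → ∀ {k} → k < n → k ℕ./ 4 < n ℕ./ 4
  quotient-bound 4∣n k<n = m<n*o⇒m/o<n (subst (_ <_) (sym (m/n*n≡m 4∣n)) k<n)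

  module _ (i : Fin n) where

    S : Rel (Vertex n) 0ℓ
    S = SymClosure (SpokelessEdge n (toℕ i))

    -- Offsets are brought to the form remainder plus quotient times 4, in which division by 4 and
    -- `period` deliver them.
    position : ∀ q r → toℕ i + 4 * q + r ≡ toℕ i + (r + q * 4)
    position q r = arithmetic (toℕ i) q r
      where
      arithmetic : ∀ i q r → i + 4 * q + r ≡ i + (r + q * 4)
      arithmetic = solve-∀

    position₀ : ∀ q → toℕ i + 4 * q ≡ toℕ i + q * 4
    position₀ q = cong (λ k → toℕ i + k) (*-comm 4 q)

    u₀u₂′ : ∀ q → q < n ℕ./ 4 → S (u (i ⊕ q * 4)) (u (i ⊕ (2 + q * 4)))
    u₀u₂′ q lt = subst₂ (λ k l → S (u (k mod n)) (u (l mod n))) (position₀ q) (position q 2) (fwd (u₀u₂ q lt))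

    u₁u₃′ : ∀ q → q < n ℕ./ 4 → S (u (i ⊕ (1 + q * 4))) (u (i ⊕ (3 + q * 4)))
    u₁u₃′ q lt = subst₂ (λ k l → S (u (k mod n)) (u (l mod n))) (position q 1) (position q 3) (fwd (u₁u₃ q lt))

    v₁v₂′ : ∀ q → q < n ℕ./ 4 → S (v (i ⊕ (1 + q * 4))) (v (i ⊕ (2 + q * 4)))
    v₁v₂′ q lt = subst₂ (λ k l → S (v (k mod n)) (v (l mod n))) (position q 1) (position q 2) (fwd (v₁v₂ q lt))

    v₃v₄′ : ∀ q → q < n ℕ./ 4 → S (v (i ⊕ (3 + q * 4))) (v (i ⊕ (4 + q * 4)))
    v₃v₄′ q lt = subst₂ (λ k l → S (v (k mod n)) (v (l mod n))) (position q 3) (position q 4) (fwd (v₃v₄ q lt))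

    S-elim : ∀ {T : Rel (Vertex n) 0ℓ} → (∀ {x y} → T x y → T y x) →
      (∀ q → T (u (i ⊕ q * 4)) (u (i ⊕ (2 + q * 4)))) →
      (∀ q → T (u (i ⊕ (1 + q * 4))) (u (i ⊕ (3 + q * 4)))) →
      (∀ q → T (v (i ⊕ (1 + q * 4))) (v (i ⊕ (2 + q * 4)))) →
      (∀ q → T (v (i ⊕ (3 + q * 4))) (v (i ⊕ (4 + q * 4)))) → S ⇒ T
    S-elim {T} T-sym u₀ u₁ v₁ v₃ (fwd e) = elim e
      where
      elim : SpokelessEdge n (toℕ i) ⇒ T
      elim (u₀u₂ q _) = subst₂ (λ k l → T (u (k mod n)) (u (l mod n))) (sym (position₀ q)) (sym (position q 2)) (u₀ q)
      elim (u₁u₃ q _) = subst₂ (λ k l → T (u (k mod n)) (u (l mod n))) (sym (position q 1)) (sym (position q 3)) (u₁ q)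
      elim (v₁v₂ q _) = subst₂ (λ k l → T (v (k mod n)) (v (l mod n))) (sym (position q 1)) (sym (position q 2)) (v₁ q)
      elim (v₃v₄ q _) = subst₂ (λ k l → T (v (k mod n)) (v (l mod n))) (sym (position q 3)) (sym (position q 4)) (v₃ q)
    S-elim T-sym u₀ u₁ v₁ v₃ (bwd e) = T-sym (S-elim T-sym u₀ u₁ v₁ v₃ (fwd e))

    S-covers : 4 ∣ n → ∀ x → ∃[ y ] S x y
    S-covers 4∣n (u j) with reachable i j
    ... | k , k<n , refl = subst (λ k → ∃ (S (u (i ⊕ k)))) (sym (m≡m%n+[m/n]*n k 4))
                             (cover (k % 4) (k ℕ./ 4) (m%n<n k 4) (quotient-bound 4∣n k<n))
      where
      cover : ∀ r q → r < 4 → q < n ℕ./ 4 → ∃ (S (u (i ⊕ (r + q * 4))))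
      cover 0 q _ lt = _ , u₀u₂′ q lt
      cover 1 q _ lt = _ , u₁u₃′ q lt
      cover 2 q _ lt = _ , symmetric _ (u₀u₂′ q lt)
      cover 3 q _ lt = _ , symmetric _ (u₁u₃′ q lt)
      cover (suc (suc (suc (suc _)))) q (s≤s (s≤s (s≤s (s≤s ())))) lt
    -- The inner edges pair the offsets 1, 2 and 3, 4, so counting from `i ⊕ 1` keeps both ends of
    -- an edge in one group of four.
    S-covers 4∣n (v j) with reachable (i ⊕ 1) j
    ... | k , k<n , refl = subst (λ j → ∃ (S (v j))) (sym (⊕-⊕ i 1 k))
                             (subst (λ k → ∃ (S (v (i ⊕ (1 + k))))) (sym (m≡m%n+[m/n]*n k 4))
                               (cover (k % 4) (k ℕ./ 4) (m%n<n k 4) (quotient-bound 4∣n k<n)))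
      where
      cover : ∀ r q → r < 4 → q < n ℕ./ 4 → ∃ (S (v (i ⊕ (1 + (r + q * 4)))))
      cover 0 q _ lt = _ , v₁v₂′ q lt
      cover 1 q _ lt = _ , symmetric _ (v₁v₂′ q lt)
      cover 2 q _ lt = _ , v₃v₄′ q lt
      cover 3 q _ lt = _ , symmetric _ (v₃v₄′ q lt)
      cover (suc (suc (suc (suc _)))) q (s≤s (s≤s (s≤s (s≤s ())))) lt

  module _ (n≥3 : 3 ≤ n) where

    Stepwise⇒TypeII : ∀ {g} → Stepwise g → (∀ i → g i ≢ sp) → TypeII n (Matching g)
    Stepwise⇒TypeII {g} step ¬sp with reach-fb (Stepwise-along step (0 mod n)) (λ k → ¬sp _)
    ... | k₀ , eq =
      (λ i s → ¬sp i (uMate≡v⇒sp s)) , 4∣n , i , to , (λ {x} {y} → from {x} {y})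
      where
      -- The pattern starts at an index labelled `fb`: the outer edge there is `u₀u₂`, and the inner
      -- edge is the `v₃v₄` of the preceding group.
      i = 0 mod n ⊕ k₀
      4∣n : 4 ∣ n
      4∣n = Stepwise⇒4∣n step ¬sp i eq
      f : ℕ → Label
      f k = g (i ⊕ k)
      open IsPerfectMatching (Matching-perfect n≥3 (Stepwise⇒Compatible step))
      f-step : ∀ k → Step (f k) (f (1 + k))
      f-step = Stepwise-along step i
      f0 : ∀ q → f (q * 4) ≡ fb
      f0 = period f-step (trans (cong g (⊕-0 i)) eq) (λ k → ¬sp (i ⊕ k))
      f1 : ∀ q → f (1 + q * 4) ≡ ff
      f1 q = after-fb f-step (q * 4) (f0 q) (¬sp _)
      f2 : ∀ q → f (2 + q * 4) ≡ bb
      f2 q = after-ff f-step (1 + q * 4) (f1 q)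
      f3 : ∀ q → f (3 + q * 4) ≡ bf
      f3 q = after-bb f-step (2 + q * 4) (f2 q)
      u-edge : ∀ k → UFwd (f k) → Matching g (u (i ⊕ k)) (u (i ⊕ (2 + k)))
      u-edge k h = trans (uMate-fwd h) (cong u (⊕-⊕′ i k 2))
      v-edge : ∀ k → VFwd (f k) → Matching g (v (i ⊕ k)) (v (i ⊕ (1 + k)))
      v-edge k h = trans (vMate-fwd h) (cong v (⊕-⊕′ i k 1))
      from : SymClosure (SpokelessEdge n (toℕ i)) ⇒ Matching g
      from = S-elim i {Matching g} M-sym
        (λ q → u-edge (q * 4) (subst UFwd (sym (f0 q)) fb))
        (λ q → u-edge (1 + q * 4) (subst UFwd (sym (f1 q)) ff))
        (λ q → v-edge (1 + q * 4) (subst VFwd (sym (f1 q)) ff))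
        (λ q → v-edge (3 + q * 4) (subst VFwd (sym (f3 q)) bf))
      -- Mates in `Matching g` are unique, so a part of it that covers every vertex is all of it.
      to : Matching g ⇒ SymClosure (SpokelessEdge n (toℕ i))
      to {x} refl with S-covers i 4∣n x
      ... | y , s = subst (SymClosure (SpokelessEdge n (toℕ i)) x) (sym (from s)) s

    module _ (n≢4 : n ≢ 4) {M : Rel (Vertex n) 0ℓ} (pm : IsPerfectMatching (P n) M) where
      open Labelling n≥3 pm

      spoke⇒sp : ∀ i → M (u i) (v i) → labelling i ≡ sp
      spoke⇒sp i m = uMate≡v⇒sp (mate-unique m)

      sp⇒spoke : ∀ i → labelling i ≡ sp → M (u i) (v i)
      sp⇒spoke i eq = subst (λ x → M (u i) (uMate x i)) eq (M-mate (u i))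

      labelling-Compatible : Compatible labelling
      labelling-Compatible = involutive⇒Compatible n≥3 n≢4 labelling-involutive

      TypeI⇒Stepwise : TypeI n M → Stepwise labelling
      TypeI⇒Stepwise typeI@((i , m) , _) =
        Gaps⇒Stepwise labelling-Compatible (TypeI⇒Gaps spoke⇒sp sp⇒spoke typeI) i (spoke⇒sp i m)

      TypeII⇒Stepwise : TypeII n M → Stepwise labelling
      TypeII⇒Stepwise (¬spoke , 4∣n , i , _ , S⊆M) =
        -- Only the step `fb→ff` at `i` is read off, from the group `k = 0` of the pattern;
        -- compatibility carries it to the other indices.
        spread labelling-Compatible (λ j eq → contradiction (sp⇒spoke j eq) (¬spoke j)) i
          (subst₂ Step (sym (first fwd₀ v-fwd₀)) (sym (second fwd₁ v-fwd₁)) fb→ff)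
        where
        open Compatible labelling-Compatible
        0<n/4 : 0 < n ℕ./ 4
        0<n/4 = m≥n⇒m/n>0 (∣⇒≤ 4∣n)
        fwd₀ : UFwd (labelling i)
        fwd₀ = uMate≡fwd⇒UFwd n≥3 n≢4 (mate-unique
          (subst (λ j → M (u j) (u (i ⊕ 2))) (⊕-0 i) (S⊆M (u₀u₂′ i 0 0<n/4))))
        fwd₁ : UFwd (labelling (i ⊕ 1))
        fwd₁ = uMate≡fwd⇒UFwd n≥3 n≢4 (mate-unique
          (subst (λ j → M (u (i ⊕ 1)) (u j)) (sym (⊕-⊕ i 1 2)) (S⊆M (u₁u₃′ i 0 0<n/4))))
        v-fwd₁ : VFwd (labelling (i ⊕ 1))
        v-fwd₁ = vMate≡fwd⇒VFwd n≥3 n≢4 (mate-unique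
          (subst (λ j → M (v (i ⊕ 1)) (v j)) (sym (⊕-⊕ i 1 1)) (S⊆M (v₁v₂′ i 0 0<n/4))))
        VFwd⇒¬VBack : ∀ {x} → VFwd x → ¬ VBack x
        VFwd⇒¬VBack bf ()
        VFwd⇒¬VBack ff ()
        v-fwd₀ : ¬ VFwd (labelling i)
        v-fwd₀ h = VFwd⇒¬VBack v-fwd₁ (v→ i h)
        first : ∀ {x} → UFwd x → ¬ VFwd x → x ≡ fb
        first fb _  = refl
        first ff ¬v = contradiction ff ¬v
        second : ∀ {x} → UFwd x → VFwd x → x ≡ ff
        second ff ff = refl

    Stepwise⇒TypeI⊎TypeII : ∀ {g} → Stepwise g → TypeI n (Matching g) ⊎ TypeII n (Matching g)
    Stepwise⇒TypeI⊎TypeII {g} step with any? (λ i → g i ≟ˡ sp)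
    ... | yes (i , eq) = inj₁ (Gaps⇒TypeI (λ i → uMate≡v⇒sp) (λ i eq → cong (λ x → uMate x i) eq)
                                i eq (Stepwise⇒Gaps step))
    ... | no none      = inj₂ (Stepwise⇒TypeII step λ i eq → none (i , eq))

-- The bijection between matchings and closed walks

ClosedWalk-≡ : ∀ {k} {w w′ : ClosedWalk k} →
               (∀ i → i ≤ k → label (proj₂ w) i ≡ label (proj₂ w′) i) → w ≡ w′
ClosedWalk-≡ {w = x , p} {w′ = y , q} eq
  with refl ← trans (sym (label-start p)) (trans (eq 0 z≤n) (label-start q)) =
  cong (x ,_) (label-injective p q eq)

module _ {n : ℕ} .{{_ : NonZero n}} where

  toWalk : (g : Fin n → Label) → Stepwise g → ClosedWalk n
  toWalk g step = g (0 mod n) , walk (λ k → g (k mod n)) step′ n (cong g (mod-≡ ([m+n]%n≡m%n 0 n)))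
    where
    step′ : ∀ k → Step (g (k mod n)) (g (suc k mod n))
    step′ k = subst (λ i → Step (g (k mod n)) (g i))
                (trans (mod-⊕ k 1) (cong (_mod n) (+-comm k 1))) (step (k mod n))

  label-toWalk : ∀ {g} (step : Stepwise g) k → k ≤ n → label (proj₂ (toWalk g step)) k ≡ g (k mod n)
  label-toWalk step k k≤n = label-walk _ _ n _ k≤n

  toWalk-cong : ∀ {g h} (step : Stepwise g) (step′ : Stepwise h) → (∀ i → g i ≡ h i) →
                toWalk g step ≡ toWalk h step′
  toWalk-cong step step′ g≗h = ClosedWalk-≡ λ k k≤n →
    trans (label-toWalk step k k≤n) (trans (g≗h (k mod n)) (sym (label-toWalk step′ k k≤n)))

  toWalk-injective : ∀ {g h} (step : Stepwise g) (step′ : Stepwise h) →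
                     toWalk g step ≡ toWalk h step′ → ∀ i → g i ≡ h i
  toWalk-injective {g} {h} step step′ eq i = begin
    g i                                        ≡⟨ cong g (mod-toℕ i) ⟨
    g (toℕ i mod n)                            ≡⟨ label-toWalk step (toℕ i) i≤n ⟨
    label (proj₂ (toWalk g step)) (toℕ i)      ≡⟨ cong (λ w → label (proj₂ w) (toℕ i)) eq ⟩
    label (proj₂ (toWalk h step′)) (toℕ i)     ≡⟨ label-toWalk step′ (toℕ i) i≤n ⟩
    h (toℕ i mod n)                            ≡⟨ cong h (mod-toℕ i) ⟩
    h i                                        ∎
    where
    open ≡-Reasoning
    i≤n : toℕ i ≤ n
    i≤n = <⇒≤ (toℕ<n i)

  fromWalk : ClosedWalk n → Fin n → Label
  fromWalk (_ , p) i = label p (toℕ i)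

  fromWalk-mod : ∀ (w : ClosedWalk n) k → k ≤ n → fromWalk w (k mod n) ≡ label (proj₂ w) k
  fromWalk-mod (x , p) k k≤n with m≤n⇒m<n∨m≡n k≤n
  ... | inj₁ k<n  = cong (label p) (trans (toℕ-mod k) (m<n⇒m%n≡m k<n))
  -- At `k = n` the index wraps to 0, where the label is the same because the walk is closed.
  ... | inj₂ refl = trans (cong (label p) (trans (toℕ-mod n) (n%n≡0 n)))
                          (trans (label-start p) (sym (label-end p)))

  fromWalk-Stepwise : ∀ w → Stepwise (fromWalk w)
  fromWalk-Stepwise w@(_ , p) i = subst (Step (label p (toℕ i)))
    (trans (sym (fromWalk-mod w (suc (toℕ i)) (toℕ<n i)))
           (cong (λ k → fromWalk w (k mod n)) (sym (+-comm (toℕ i) 1))))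
    (label-step p (toℕ<n i))

  toWalk-fromWalk : ∀ w {g} (step : Stepwise g) → (∀ i → g i ≡ fromWalk w i) → toWalk g step ≡ w
  toWalk-fromWalk w step eq = ClosedWalk-≡ λ k k≤n →
    trans (label-toWalk step k k≤n) (trans (eq (k mod n)) (fromWalk-mod w k k≤n))

module _ {n : ℕ} .{{_ : NonZero n}} (n≥3 : 3 ≤ n) (n≢4 : n ≢ 4) where

  open Setoid (𝓜₂ n) using (Carrier; _≈_)

  labels : Carrier → Fin n → Label
  labels (M , m) = Labelling.labelling n≥3 {M} (IsM₂.isPerfectMatching m)

  labels-Stepwise : ∀ M → Stepwise (labels M)
  labels-Stepwise (_ , m) with IsM₂.n≢4⇒ m n≢4
  ... | inj₁ typeI  = TypeI⇒Stepwise n≥3 n≢4 (IsM₂.isPerfectMatching m) typeI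
  ... | inj₂ typeII = TypeII⇒Stepwise n≥3 n≢4 (IsM₂.isPerfectMatching m) typeII

  mate-labels : ∀ M {x y} → proj₁ M x y → mate (labels M) x ≡ y
  mate-labels (M , m) Mxy = Labelling.mate-unique n≥3 {M} (IsM₂.isPerfectMatching m) Mxy

  M-labels : ∀ M x → proj₁ M x (mate (labels M) x)
  M-labels (M , m) = Labelling.M-mate n≥3 {M} (IsM₂.isPerfectMatching m)

  labels-cong : ∀ {M N} → M ≈ N → ∀ i → labels M i ≡ labels N i
  labels-cong {M} {N} (M⊆N , _) =
    mate-injective n≥3 n≢4 λ x → sym (mate-labels N (M⊆N (M-labels M x)))

  labels-⊆ : ∀ M N → (∀ i → labels M i ≡ labels N i) → proj₁ M ⇒ proj₁ N
  labels-⊆ M N eq {x} {y} m = subst (proj₁ N x) (trans (mate-cong x) (mate-labels M m)) (M-labels N x)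
    where
    mate-cong : ∀ x → mate (labels N) x ≡ mate (labels M) x
    mate-cong (u i) = cong (λ l → uMate l i) (sym (eq i))
    mate-cong (v i) = cong (λ l → vMate l i) (sym (eq i))

  fromLabels : ∀ g → Stepwise g → Carrier
  fromLabels g step = Matching g , record
    { isPerfectMatching = Matching-perfect n≥3 (Stepwise⇒Compatible step)
    ; n≢4⇒              = λ _ → Stepwise⇒TypeI⊎TypeII n≥3 step
    ; n≡4⇒              = λ n≡4 → contradiction n≡4 n≢4
    }

  labels-fromLabels : ∀ g step i → labels (fromLabels g step) i ≡ g i
  labels-fromLabels g step = mate-injective n≥3 n≢4 λ x → mate-labels (fromLabels g step) {x} refl

  cardinality : HasCardinality (𝓜₂ n) (closedWalks n)
  cardinality = record
    { to        = index
    ; cong      = λ {M} {N} M≈N → cong to (toWalk-cong (labels-Stepwise M) (labels-Stepwise N) (labels-cong {M} {N} M≈N))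
    ; bijective = (λ {M} {N} → injective M N) , surjective
    }
    where
    walks↔ = ClosedWalk↔Fin n
    open Inverse walks↔ using (to; from; strictlyInverseˡ)
    index : Carrier → Fin (closedWalks n)
    index M = to (toWalk (labels M) (labels-Stepwise M))
    injective : ∀ M N → index M ≡ index N → M ≈ N
    injective M N eq =
      (λ {x} {y} → labels-⊆ M N labels≡ {x} {y}) , (λ {x} {y} → labels-⊆ N M (λ i → sym (labels≡ i)) {x} {y})
      where
      labels≡ : ∀ i → labels M i ≡ labels N i
      labels≡ = toWalk-injective (labels-Stepwise M) (labels-Stepwise N)
                  (Injection.injective (Inverse⇒Injection walks↔) eq)
    surjective : ∀ c → ∃[ M ] (∀ {N} → N ≈ M → index N ≡ c)
    surjective c = M , λ {N} N≈M → trans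
      (cong to (toWalk-fromWalk (from c) (labels-Stepwise N) λ i →
        trans (labels-cong {N} {M} N≈M i) (labels-fromLabels (fromWalk (from c)) step i)))
      (strictlyInverseˡ c)
      where
      step : Stepwise (fromWalk (from c))
      step = fromWalk-Stepwise (from c)
      M : Carrier
      M = fromLabels (fromWalk (from c)) step

-- The exceptional length 4

cardinality-4 : HasCardinality (𝓜₂ 4) 1
cardinality-4 = record
  { to        = λ _ → zero
  ; cong      = λ _ → refl
  ; bijective =
      (λ {M} {N} _ → let M⊆E , E⊆M = IsM₂.n≡4⇒ (proj₂ M) refl
                         N⊆E , E⊆N = IsM₂.n≡4⇒ (proj₂ N) refl
                     in (λ m → E⊆N (M⊆E m)) , λ m → E⊆M (N⊆E m))
    , λ { zero → (Matching g , isM₂) , λ _ → refl }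
  }
  where
  -- One long block, entered at its `fb`. A stepwise labelling still yields a perfect matching at
  -- this length; it is the reading of labels off a matching that breaks down.
  g : Fin 4 → Label
  g zero                   = fb
  g (suc zero)             = ff
  g (suc (suc zero))       = bb
  g (suc (suc (suc zero))) = bf
  step : Stepwise g
  step zero                   = fb→ff
  step (suc zero)             = ff→bb
  step (suc (suc zero))       = bb→bf
  step (suc (suc (suc zero))) = bf→fb
  to : ∀ x → SymClosure (ExceptionalEdge 4) x (mate g x)
  to (u zero)                   = fwd u₀u₂
  to (u (suc zero))             = fwd u₁u₃
  to (u (suc (suc zero)))       = bwd u₀u₂
  to (u (suc (suc (suc zero)))) = bwd u₁u₃
  to (v zero)                   = bwd v₃v₀
  to (v (suc zero))             = fwd v₁v₂
  to (v (suc (suc zero)))       = bwd v₁v₂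
  to (v (suc (suc (suc zero)))) = fwd v₃v₀
  from : SymClosure (ExceptionalEdge 4) ⇒ Matching g
  from (fwd u₀u₂) = refl
  from (fwd u₁u₃) = refl
  from (fwd v₁v₂) = refl
  from (fwd v₃v₀) = refl
  from (bwd u₀u₂) = refl
  from (bwd u₁u₃) = refl
  from (bwd v₁v₂) = refl
  from (bwd v₃v₀) = refl
  isM₂ : IsM₂ 4 (Matching g)
  isM₂ = record
    { isPerfectMatching = Matching-perfect (s≤s (s≤s (s≤s z≤n))) (Stepwise⇒Compatible step)
    ; n≢4⇒              = λ n≢4 → contradiction refl n≢4
    ; n≡4⇒              = λ _ → (λ { {x} refl → to x }) , from
    }

theorem2p2 : ∀ (n : ℕ) .{{_ : NonZero n}} → n ≥ 3 →
    ∃[ c ] HasCardinality (𝓜₂ n) c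
    × (n ≡ 4 → c ≡ 1)
    × (n ≢ 4 → (+ c) / 1 ≡ formula n)
theorem2p2 n n≥3 with n ≟ 4
... | yes refl = 1 , cardinality-4 , (λ _ → refl) , λ n≢4 → contradiction refl n≢4
... | no n≢4 = closedWalks n , cardinality n≥3 n≢4 , (λ n≡4 → contradiction n≡4 n≢4) , λ _ → count n n≥3
  where
  count : ∀ n .{{_ : NonZero n}} → n ≥ 3 → (+ closedWalks n) / 1 ≡ formula n
  -- The general count concerns lengths `4 + m`, so the smallest length is evaluated directly.
  count 3 _ = refl
  count (suc (suc (suc (suc m)))) _ = sym (formula≡closedWalks m)
  count 1 (s≤s ())
  count 2 (s≤s (s≤s ()))
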